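{- For $n\ge1$ and $0\le k\le n$: (a) the coefficients $b_{n,k}$ are integers; (b) $a_{n,k}\ge0$ and $b_{n,k}\ge0$; (c) $a_{n,k-1}\le a_{n,k}$ for $1\le k\le n$; (d) $a_{n,0}=(n-1)!$.
   Context: Let $V$ be the unique solution, in the ring of formal series $\sum_{n\ge0}q_n(y)x^{ -n}$ with $q_n$ complex polynomials of degree $\le n$, of $V=1+\frac{y}{x}-\frac{1}{x}V-V_x-\frac{1}{x}V_y+\frac{1}{x}\log V$ (termwise formal derivatives $V_x,V_y$; formal logarithm series). Define polynomials $P_{n-1}$, $Q_n$ by $V=1+\sum_{n\ge1}P_{n-1}(y)x^{ -n}$, $\log V=\sum_{n\ge1}Q_n(y)x^{ -n}$; equivalently $P_0=y-1$ and $P_n=nP_{n-1}-P'_{n-1}+\frac1n\sum_{k=1}^{n-1}k\{(k-1)P_{k-1}-P_k-P'_{k-1}\}P_{n-k-1}$. For $n\ge1$ define $a_{n,k},b_{n,k}$ ($0\le k\le n$) by $P_n(y)=\frac{(-1)^{n+1}}{n!}\sum_{k=0}^n(-1)^ka_{n,k}y^{n-k}$ and $Q_n(y)=\frac{(-1)^{n+1}}{n!}\sum_{k=0}^n(-1)^kb_{n,k}y^{n-k}$. -}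

module Defs where

open import Level using (Level; _⊔_) renaming (suc to lsuc)
open import Algebra.Bundles using (CommutativeRing)
open import Algebra.Morphism.Structures using (module RingMorphisms)
open import Data.Bool.Base using (if_then_else_)
open import Data.Fin.Base using (toℕ)
open import Data.Integer.Base using (+_)
open import Data.Nat.Base as ℕ using (ℕ; zero; suc; _∸_; _≡ᵇ_; _!)
open import Data.Nat.Properties using (_!≢0)
open import Data.Product.Base using (∃-syntax)
open import Data.Rational.Base as ℚ using (ℚ)
open import Relation.Binary.Core using (Rel)
open import Relation.Binary.Morphism.Structures using (IsOrderMonomorphism)
open import Relation.Binary.PropositionalEquality.Core using (_≡_)
open import Relation.Binary.Structures using (IsPartialOrder)
import Algebra.Properties.Semiring.Exp as SemiringExp
import Algebra.Properties.Semiring.Mult as SemiringMult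
import Algebra.Properties.Semiring.Sum as SemiringSum

-- The scalars.  ℂ is an instance, with z ≤ w meaning that w - z is real and
-- nonnegative (so 0 ≤ z says that z is a nonnegative real number); ℝ and ℚ
-- are further instances.
record PartiallyOrderedExtensionOfℚ (c ℓ₁ ℓ₂ : Level) : Set (lsuc (c ⊔ ℓ₁ ⊔ ℓ₂)) where
  infix 4 _≤_
  field
    commutativeRing : CommutativeRing c ℓ₁

  open CommutativeRing commutativeRing public

  field
    _≤_                   : Rel Carrier ℓ₂
    isPartialOrder        : IsPartialOrder _≈_ _≤_
    +-mono-≤              : ∀ {w x y z} → w ≤ x → y ≤ z → w + y ≤ x + z
    *-nonNegative         : ∀ {x y} → 0# ≤ x → 0# ≤ y → 0# ≤ x * y
    ι                     : ℚ → Carrier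
    ι-isRingMonomorphism  : RingMorphisms.IsRingMonomorphism ℚ.+-*-rawRing rawRing ι
    ι-isOrderMonomorphism : IsOrderMonomorphism _≡_ _≈_ ℚ._≤_ _≤_ ι

module Expansion {c ℓ₁ ℓ₂ : Level} (K : PartiallyOrderedExtensionOfℚ c ℓ₁ ℓ₂) where

  open PartiallyOrderedExtensionOfℚ K
  open SemiringExp semiring using (_^_)
  open SemiringMult semiring using (_×_)
  open SemiringSum semiring using (sum-syntax; sum⁺-syntax)

  IsInteger : Carrier → Set ℓ₁
  IsInteger x = ∃[ z ] x ≈ ι (z ℚ./ 1)

  recip : (n : ℕ) .{{_ : ℕ.NonZero n}} → Carrier
  recip n = ι ((+ 1) ℚ./ n)

  recip! : ℕ → Carrier
  recip! n = recip (n !) {{n !≢0}}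

  -- p j is the coefficient of y^j; finiteness is imposed by DegreeAtMost.
  Poly : Set c
  Poly = ℕ → Carrier

  DegreeAtMost : ℕ → Poly → Set ℓ₁
  DegreeAtMost d p = ∀ j → d ℕ.< j → p j ≈ 0#

  infix 4 _≈ᵖ_
  _≈ᵖ_ : Poly → Poly → Set ℓ₁
  p ≈ᵖ q = ∀ j → p j ≈ q j

  0ᵖ : Poly
  0ᵖ j = 0#

  y^_ : ℕ → Poly
  (y^ m) j = if m ≡ᵇ j then 1# else 0#

  _*ᵖ_ : Poly → Poly → Poly
  (p *ᵖ q) j = ∑[ i ≤ j ] (p (toℕ i) * q (j ∸ toℕ i))

  d/dy : Poly → Poly
  d/dy p j = suc j × p (suc j)

  -- f n is the coefficient of x^{-n}.
  Series : Set c
  Series = ℕ → Poly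

  infix 4 _≈ˢ_
  _≈ˢ_ : Series → Series → Set ℓ₁
  f ≈ˢ g = ∀ n → f n ≈ᵖ g n

  constant : Poly → Series
  constant p zero    = p
  constant p (suc n) = 0ᵖ

  1ˢ : Series
  1ˢ = constant (y^ 0)

  yˢ : Series
  yˢ = constant (y^ 1)

  infixl 6 _+ˢ_ _-ˢ_
  _+ˢ_ : Series → Series → Series
  (f +ˢ g) n j = f n j + g n j

  _-ˢ_ : Series → Series → Series
  (f -ˢ g) n j = f n j - g n j

  infixl 7 _*ˢ_
  _*ˢ_ : Series → Series → Series
  (f *ˢ g) n j = ∑[ i ≤ n ] ((f (toℕ i) *ᵖ g (n ∸ toℕ i)) j)

  infixr 8 _^ˢ_
  _^ˢ_ : Series → ℕ → Series
  f ^ˢ zero  = 1ˢ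
  f ^ˢ suc m = f *ˢ f ^ˢ m

  infixr 9 x⁻¹·_
  x⁻¹·_ : Series → Series
  (x⁻¹· f) zero    = 0ᵖ
  (x⁻¹· f) (suc n) = f n

  ∂x : Series → Series
  ∂x f zero    j = 0#
  ∂x f (suc n) j = - (n × f n j)

  ∂y : Series → Series
  ∂y f n = d/dy (f n)

  -- log f = Σ_{m≥1} (-1)^{m-1} (f-1)^m / m.  When f has constant term 1, the
  -- series (f-1)^m starts at x^{-m}, so the terms with m > n do not contribute
  -- to the coefficient of x^{-n}.  The index i below is m - 1.
  log : Series → Series
  log f n j = ∑[ i < n ]
    ((- 1#) ^ toℕ i * recip (suc (toℕ i)) * ((f -ˢ 1ˢ) ^ˢ suc (toℕ i)) n j)

  record FormalSeries : Set (c ⊔ ℓ₁) where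
    field
      coeff  : Series
      degree : ∀ n → DegreeAtMost n (coeff n)

  open FormalSeries public

  -- The coefficient of x⁰ in this equation says that V has constant term 1, as
  -- the logarithm requires.
  IsSolution : FormalSeries → Set ℓ₁
  IsSolution 𝓥 =
    V ≈ˢ 1ˢ +ˢ x⁻¹· yˢ -ˢ x⁻¹· V -ˢ ∂x V -ˢ x⁻¹· ∂y V +ˢ x⁻¹· log V
    where V = coeff 𝓥

  P : FormalSeries → ℕ → Poly
  P V n = coeff V (suc n)

  Q : FormalSeries → ℕ → Poly
  Q V n = log (coeff V) n

  signedExpansion : ℕ → (ℕ → Carrier) → Poly
  signedExpansion n c j =
    (- 1#) ^ suc n * recip! n * ∑[ k ≤ n ] ((- 1#) ^ toℕ k * c (toℕ k) * (y^ (n ∸ toℕ k)) j)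

  -- The families a and b are determined by R only for 1 ≤ n and k ≤ n.
  AreCoefficientsOf : (ℕ → ℕ → Carrier) → (ℕ → Poly) → Set ℓ₁
  AreCoefficientsOf a R = ∀ n → 1 ℕ.≤ n → R n ≈ᵖ signedExpansion n (a n)

{-# OPTIONS --safe #-}
module Submission where

-- Put z = 1/x, t = - y, and write V = 1 - U(z, t) and - log V = Σ Uᵐ/m.  With
-- P_n = - A_n(t)/n! and Q_n = - B_n(t)/n!, the equation for V reads
-- A_{n+1} = (n+1) (n A_n + A_n') + B_{n+1}, and applying z ∂/∂z to the logarithm gives B_n as
-- a polynomial in A_0, …, A_{n-1} with natural number coefficients.  As A_0 = 1 + t, all
-- coefficients of A_n and B_n are natural numbers.
--
-- For the monotonicity, V also satisfies the linear equation V + x V_x + (1 - x) V_y = 0.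
-- Together with the original equation it gives A_n = A_n' + B_n, so that the coefficient of tʲ
-- in A_n is at least j + 1 times that of tʲ⁺¹.  Comparing the leading coefficients in the linear
-- equation gives a_{n+1,0} = n a_{n,0}.

open import Defs
open import Level using (Level; _⊔_)
open import Algebra.Bundles using (CommutativeRing)
open import Algebra.Morphism.Structures using (module RingMorphisms)
open import Algebra.Solver.Ring.AlmostCommutativeRing
  using (_-Raw-AlmostCommutative⟶_; fromCommutativeRing)
open import Data.Fin.Base using (Fin; suc; toℕ)
open import Data.Fin.Properties using (toℕ≤pred[n])
open import Data.Integer.Base as ℤ using (+_)
import Data.Integer.Properties as ℤ
open import Data.Maybe.Base using (Maybe; map)
open import Data.Nat.Base as ℕ using (ℕ; zero; suc; z≤n; s≤s; _∸_; _!)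
open import Data.Nat.Combinatorics using (k![n∸k]!∣n!)
open import Data.Nat.Divisibility.Core using (_∣_; quotient)
open import Data.Nat.Induction using (<-rec)
import Data.Nat.Properties as ℕ
open import Data.Product.Base using (∃-syntax; Σ-syntax; _,_; proj₁; proj₂)
open import Data.Rational.Base as ℚ using (ℚ; toℚᵘ)
import Data.Rational.Properties as ℚ
open import Data.Rational.Unnormalised.Base as ℚᵘ using (mkℚᵘ; *≡*)
import Data.Rational.Unnormalised.Properties as ℚᵘ
open import Data.Sum.Base using (inj₁; inj₂)
open import Relation.Binary.Morphism.Structures using (IsOrderMonomorphism)
open import Relation.Binary.PropositionalEquality.Core as ≡ using (_≡_; _≢_; cong)
open import Relation.Binary.Structures using (IsPartialOrder)
open import Relation.Nullary.Decidable.Core using (dec⇒maybe)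
open import Relation.Nullary.Negation.Core using (contradiction)
import Algebra.Construct.Pointwise as Pointwise
import Algebra.Properties.CommutativeMonoid.Mult as CommutativeMonoidMult
import Algebra.Properties.CommutativeSemigroup as CommutativeSemigroupProperties
import Algebra.Properties.Ring as RingProperties
import Algebra.Properties.Semiring.Exp as SemiringExp
import Algebra.Properties.Semiring.Mult as SemiringMult
import Algebra.Properties.Semiring.Sum as SemiringSum
import Algebra.Solver.Ring as RingSolver
import Relation.Binary.Reasoning.Setoid as ≈-Reasoning

-- Natural numbers and reciprocals inside ℚ.

1+n/1≡[1+n]/1 : ∀ n → ℚ.1ℚ ℚ.+ (+ n ℚ./ 1) ≡ + suc n ℚ./ 1
-- The normalisation in `ℚ./` does not compute for a variable `n`; on unnormalised fractions the
-- equation is one between integers.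
1+n/1≡[1+n]/1 n = ℚ.toℚᵘ-injective (begin
  toℚᵘ (ℚ.1ℚ ℚ.+ (+ n ℚ./ 1))       ≈⟨ ℚ.toℚᵘ-homo-+ ℚ.1ℚ (+ n ℚ./ 1) ⟩
  ℚᵘ.1ℚᵘ ℚᵘ.+ toℚᵘ (+ n ℚ./ 1)      ≈⟨ ℚᵘ.+-congʳ ℚᵘ.1ℚᵘ (ℚ.toℚᵘ-fromℚᵘ (mkℚᵘ (+ n) 0)) ⟩
  ℚᵘ.1ℚᵘ ℚᵘ.+ mkℚᵘ (+ n) 0
    ≈⟨ *≡* (cong (λ z → (+ 1 ℤ.+ z) ℤ.* + 1) (ℤ.*-identityʳ (+ n))) ⟩
  mkℚᵘ (+ suc n) 0                  ≈⟨ ℚ.toℚᵘ-fromℚᵘ (mkℚᵘ (+ suc n) 0) ⟨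
  toℚᵘ (+ suc n ℚ./ 1)              ∎)
  where open ≈-Reasoning ℚᵘ.≃-setoid

1/n*n/1≡1 : ∀ n .{{_ : ℕ.NonZero n}} → (+ 1 ℚ./ n) ℚ.* (+ n ℚ./ 1) ≡ ℚ.1ℚ
1/n*n/1≡1 n@(suc m) = ℚ.toℚᵘ-injective (begin
  toℚᵘ ((+ 1 ℚ./ n) ℚ.* (+ n ℚ./ 1))          ≈⟨ ℚ.toℚᵘ-homo-* (+ 1 ℚ./ n) (+ n ℚ./ 1) ⟩
  toℚᵘ (+ 1 ℚ./ n) ℚᵘ.* toℚᵘ (+ n ℚ./ 1)
    ≈⟨ ℚᵘ.*-cong (ℚ.toℚᵘ-fromℚᵘ (mkℚᵘ (+ 1) m)) (ℚ.toℚᵘ-fromℚᵘ (mkℚᵘ (+ n) 0)) ⟩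
  mkℚᵘ (+ 1) m ℚᵘ.* mkℚᵘ (+ n) 0              ≈⟨ ℚᵘ.*-inverseˡ (mkℚᵘ (+ n) 0) ⟩
  ℚᵘ.1ℚᵘ                                      ∎)
  where open ≈-Reasoning ℚᵘ.≃-setoid

-- Formal power series over a commutative ring.

module PowerSeries {c ℓ : Level} (R : CommutativeRing c ℓ) where

  open CommutativeRing R
  open CommutativeMonoidMult +-commutativeMonoid using (×-distrib-+)
  open CommutativeSemigroupProperties +-commutativeSemigroup using (interchange; x∙yz≈y∙xz)
  open SemiringMult semiring using (_×_; ×-comm-*)
  open SemiringSum semiring using (sum⁺-syntax)
  open ≈-Reasoning setoid

  infixl 7 _∗_ _·_
  infixl 6 _⊕_

  _⊕_ : (ℕ → Carrier) → (ℕ → Carrier) → ℕ → Carrier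
  (f ⊕ g) n = f n + g n

  _·_ : Carrier → (ℕ → Carrier) → ℕ → Carrier
  (x · f) n = x * f n

  shift : (ℕ → Carrier) → ℕ → Carrier
  shift f n = f (suc n)

  one : ℕ → Carrier
  one zero    = 1#
  one (suc n) = 0#

  -- The summand of index 0 splits off definitionally:
  -- (f ∗ g) (suc n) is f 0 * g (suc n) + (shift f ∗ g) n.
  _∗_ : (ℕ → Carrier) → (ℕ → Carrier) → ℕ → Carrier
  (f ∗ g) n = ∑[ i ≤ n ] (f (toℕ i) * g (n ∸ toℕ i))

  -- A coefficient of a product sees only the coefficients up to its own index. This later allows
  -- `log V` to be replaced by a partial sum.
  ∗-cong-≤ : ∀ n {f f′ g g′} →
             (∀ k → k ℕ.≤ n → f k ≈ f′ k) → (∀ k → k ℕ.≤ n → g k ≈ g′ k) →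
             (f ∗ g) n ≈ (f′ ∗ g′) n
  ∗-cong-≤ zero    f≈f′ g≈g′ = +-congʳ (*-cong (f≈f′ 0 z≤n) (g≈g′ 0 z≤n))
  ∗-cong-≤ (suc n) f≈f′ g≈g′ =
    +-cong (*-cong (f≈f′ 0 z≤n) (g≈g′ (suc n) ℕ.≤-refl))
           (∗-cong-≤ n (λ k k≤n → f≈f′ (suc k) (s≤s k≤n))
                       (λ k k≤n → g≈g′ k (ℕ.m≤n⇒m≤1+n k≤n)))

  ∗-cong : ∀ {f f′ g g′} → (∀ k → f k ≈ f′ k) → (∀ k → g k ≈ g′ k) →
           ∀ n → (f ∗ g) n ≈ (f′ ∗ g′) n
  ∗-cong f≈f′ g≈g′ n = ∗-cong-≤ n (λ k _ → f≈f′ k) (λ k _ → g≈g′ k)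

  ∗-zeroˡ : ∀ {f} g n → (∀ k → k ℕ.≤ n → f k ≈ 0#) → (f ∗ g) n ≈ 0#
  ∗-zeroˡ g zero    f≈0 = trans (+-identityʳ _) (trans (*-congʳ (f≈0 0 z≤n)) (zeroˡ _))
  ∗-zeroˡ g (suc n) f≈0 =
    trans (+-cong (trans (*-congʳ (f≈0 0 z≤n)) (zeroˡ _))
                  (∗-zeroˡ g n (λ k k≤n → f≈0 (suc k) (s≤s k≤n))))
          (+-identityˡ 0#)

  ∗-distribʳ-⊕ : ∀ h f g n → ((f ⊕ g) ∗ h) n ≈ (f ∗ h) n + (g ∗ h) n
  ∗-distribʳ-⊕ h f g zero = begin
    (f 0 + g 0) * h 0 + 0#              ≈⟨ +-cong (distribʳ _ _ _) (sym (+-identityˡ 0#)) ⟩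
    f 0 * h 0 + g 0 * h 0 + (0# + 0#)   ≈⟨ interchange _ _ _ _ ⟩
    (f ∗ h) 0 + (g ∗ h) 0               ∎
  ∗-distribʳ-⊕ h f g (suc n) =
    trans (+-cong (distribʳ _ _ _) (∗-distribʳ-⊕ h (shift f) (shift g) n)) (interchange _ _ _ _)

  -- Peeling the constant term off both factors leaves the products of the two shifts in either
  -- order, so the induction descends by one and by two.
  ∗-comm : ∀ f g n → (f ∗ g) n ≈ (g ∗ f) n
  ∗-comm f g zero          = +-congʳ (*-comm _ _)
  ∗-comm f g (suc zero)    = begin
    f 0 * g 1 + (f 1 * g 0 + 0#)   ≈⟨ x∙yz≈y∙xz _ _ _ ⟩
    f 1 * g 0 + (f 0 * g 1 + 0#)   ≈⟨ +-cong (*-comm _ _) (+-congʳ (*-comm _ _)) ⟩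
    g 0 * f 1 + (g 1 * f 0 + 0#)   ∎
  ∗-comm f g (suc (suc n)) = begin
    f 0 * g (suc (suc n)) + (shift f ∗ g) (suc n)
      ≈⟨ +-congˡ (∗-comm (shift f) g (suc n)) ⟩
    f 0 * g (suc (suc n)) + (g 0 * f (suc (suc n)) + (shift g ∗ shift f) n)
      ≈⟨ x∙yz≈y∙xz _ _ _ ⟩
    g 0 * f (suc (suc n)) + (f 0 * g (suc (suc n)) + (shift g ∗ shift f) n)
      ≈⟨ +-congˡ (+-congˡ (∗-comm (shift g) (shift f) n)) ⟩
    g 0 * f (suc (suc n)) + (f ∗ shift g) (suc n)
      ≈⟨ +-congˡ (∗-comm f (shift g) (suc n)) ⟩
    (g ∗ f) (suc (suc n)) ∎

  ∗-zeroʳ : ∀ f {g} n → (∀ k → k ℕ.≤ n → g k ≈ 0#) → (f ∗ g) n ≈ 0#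
  ∗-zeroʳ f {g} n g≈0 = trans (∗-comm f g n) (∗-zeroˡ f n g≈0)

  ∗-distribˡ-⊕ : ∀ h f g n → (h ∗ (f ⊕ g)) n ≈ (h ∗ f) n + (h ∗ g) n
  ∗-distribˡ-⊕ h f g n = begin
    (h ∗ (f ⊕ g)) n        ≈⟨ ∗-comm h (f ⊕ g) n ⟩
    ((f ⊕ g) ∗ h) n        ≈⟨ ∗-distribʳ-⊕ h f g n ⟩
    (f ∗ h) n + (g ∗ h) n  ≈⟨ +-cong (∗-comm f h n) (∗-comm g h n) ⟩
    (h ∗ f) n + (h ∗ g) n  ∎

  ·-∗-assoc : ∀ x f g n → (x · f ∗ g) n ≈ x * (f ∗ g) n
  ·-∗-assoc x f g zero    =
    trans (+-cong (*-assoc _ _ _) (sym (zeroʳ x))) (sym (distribˡ _ _ _))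
  ·-∗-assoc x f g (suc n) =
    trans (+-cong (*-assoc _ _ _) (·-∗-assoc x (shift f) g n)) (sym (distribˡ _ _ _))

  ∗-assoc : ∀ f g h n → ((f ∗ g) ∗ h) n ≈ (f ∗ (g ∗ h)) n
  ∗-assoc f g h zero    = +-congʳ (begin
    (f 0 * g 0 + 0#) * h 0   ≈⟨ *-congʳ (+-identityʳ _) ⟩
    f 0 * g 0 * h 0          ≈⟨ *-assoc _ _ _ ⟩
    f 0 * (g 0 * h 0)        ≈⟨ *-congˡ (+-identityʳ _) ⟨
    f 0 * (g 0 * h 0 + 0#)   ∎)
  ∗-assoc f g h (suc n) = begin
    (f 0 * g 0 + 0#) * h (suc n) + ((f 0 · shift g ⊕ shift f ∗ g) ∗ h) n
      ≈⟨ +-cong (trans (*-congʳ (+-identityʳ _)) (*-assoc _ _ _))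
                (∗-distribʳ-⊕ h (f 0 · shift g) (shift f ∗ g) n) ⟩
    f 0 * (g 0 * h (suc n)) + ((f 0 · shift g ∗ h) n + ((shift f ∗ g) ∗ h) n)
      ≈⟨ +-congˡ (+-cong (·-∗-assoc (f 0) (shift g) h n) (∗-assoc (shift f) g h n)) ⟩
    f 0 * (g 0 * h (suc n)) + (f 0 * (shift g ∗ h) n + (shift f ∗ (g ∗ h)) n)
      ≈⟨ +-assoc _ _ _ ⟨
    f 0 * (g 0 * h (suc n)) + f 0 * (shift g ∗ h) n + (shift f ∗ (g ∗ h)) n
      ≈⟨ +-congʳ (distribˡ _ _ _) ⟨
    (f ∗ (g ∗ h)) (suc n) ∎

  ∗-identityˡ : ∀ f n → (one ∗ f) n ≈ f n
  ∗-identityˡ f zero    = trans (+-identityʳ _) (*-identityˡ _)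
  ∗-identityˡ f (suc n) =
    trans (+-cong (*-identityˡ _) (∗-zeroˡ f n (λ _ _ → refl))) (+-identityʳ _)

  ∗-identityʳ : ∀ f n → (f ∗ one) n ≈ f n
  ∗-identityʳ f n = trans (∗-comm f one n) (∗-identityˡ f n)

  -- Having the ring again as a `CommutativeRing` lets the construction be iterated: polynomials in
  -- y sit in series over the scalars, and series in x⁻¹ are series over those.
  commutativeRing : CommutativeRing c ℓ
  commutativeRing = record
    { _≈_ = λ f g → ∀ n → f n ≈ g n
    ; _+_ = _⊕_
    ; _*_ = _∗_
    ; -_  = λ f n → - f n
    ; 0#  = λ _ → 0#
    ; 1#  = one
    ; isCommutativeRing = record
      { isRing = record
        { +-isAbelianGroup = Pointwise.isAbelianGroup ℕ +-isAbelianGroup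
        ; *-cong           = ∗-cong
        ; *-assoc          = ∗-assoc
        ; *-identity       = ∗-identityˡ , ∗-identityʳ
        ; distrib          = ∗-distribˡ-⊕ , ∗-distribʳ-⊕
        }
      ; *-comm = ∗-comm
      }
    }

  -- The lowest nonzero coefficient of `g` would survive in the product. The truncated form fits an
  -- induction in which the product is known to vanish only up to some index.
  ∗-cancelˡ-≤ : ∀ n {f g} → f 0 ≈ 1# → (∀ k → k ℕ.≤ n → (f ∗ g) k ≈ 0#) →
                ∀ k → k ℕ.≤ n → g k ≈ 0#
  ∗-cancelˡ-≤ n {f} {g} f₀≈1 fg≈0 = λ k → below (suc k) k ℕ.≤-refl
    where
    -- The bound `m` makes the strong induction on `k` structural.
    below : ∀ m k → k ℕ.< m → k ℕ.≤ n → g k ≈ 0#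
    below (suc m) zero    _         k≤n = begin
      g 0             ≈⟨ *-identityˡ _ ⟨
      1# * g 0        ≈⟨ *-congʳ f₀≈1 ⟨
      f 0 * g 0       ≈⟨ +-identityʳ _ ⟨
      (f ∗ g) 0       ≈⟨ fg≈0 0 k≤n ⟩
      0#              ∎
    below (suc m) (suc k) (s≤s k<m) k≤n = begin
      g (suc k)                            ≈⟨ *-identityˡ _ ⟨
      1# * g (suc k)                       ≈⟨ *-congʳ f₀≈1 ⟨
      f 0 * g (suc k)                      ≈⟨ +-identityʳ _ ⟨
      f 0 * g (suc k) + 0#
        ≈⟨ +-congˡ (∗-zeroʳ (shift f) k
             (λ i i≤k → below m i (ℕ.≤-<-trans i≤k k<m) (ℕ.≤-trans i≤k (ℕ.<⇒≤ k≤n)))) ⟨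
      (f ∗ g) (suc k)                      ≈⟨ fg≈0 (suc k) k≤n ⟩
      0#                                   ∎

  -- The Euler operator z d/dz in the series variable z; for z = 1/x it is - x d/dx.
  θ : (ℕ → Carrier) → ℕ → Carrier
  θ f n = n × f n

  -- Once the constant term of `f` is peeled off, the factor n + 1 on the tail is one copy plus `θ`
  -- at `n`; the extra copy completes `θ (shift f)` to `shift (θ f)`.
  θ-leibniz : ∀ f g n → θ (f ∗ g) n ≈ (θ f ∗ g) n + (f ∗ θ g) n
  θ-leibniz f g zero    = sym (trans
    (+-cong (trans (+-identityʳ _) (zeroˡ _)) (trans (+-identityʳ _) (zeroʳ _)))
    (+-identityˡ 0#))
  θ-leibniz f g (suc n) = begin
    suc n × (f 0 * g (suc n) + (shift f ∗ g) n)
      ≈⟨ ×-distrib-+ _ _ (suc n) ⟩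
    suc n × (f 0 * g (suc n)) + ((shift f ∗ g) n + θ (shift f ∗ g) n)
      ≈⟨ +-cong (sym (×-comm-* (suc n) _ _)) (+-congˡ (θ-leibniz (shift f) g n)) ⟩
    f 0 * θ g (suc n) + ((shift f ∗ g) n + ((θ (shift f) ∗ g) n + (shift f ∗ θ g) n))
      ≈⟨ +-congˡ (+-assoc _ _ _) ⟨
    f 0 * θ g (suc n) + ((shift f ∗ g) n + (θ (shift f) ∗ g) n + (shift f ∗ θ g) n)
      ≈⟨ x∙yz≈y∙xz _ _ _ ⟩
    (shift f ∗ g) n + (θ (shift f) ∗ g) n + (f ∗ θ g) (suc n)
      ≈⟨ +-congʳ (∗-distribʳ-⊕ g (shift f) (θ (shift f)) n) ⟨
    ((shift f ⊕ θ (shift f)) ∗ g) n + (f ∗ θ g) (suc n)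
      ≈⟨ +-congʳ (trans (+-congʳ (zeroˡ _)) (+-identityˡ _)) ⟨
    (θ f ∗ g) (suc n) + (f ∗ θ g) (suc n) ∎

  -- `θ f` is z f′, and the shift divides by z.
  derivative : (ℕ → Carrier) → ℕ → Carrier
  derivative f = shift (θ f)

  θ-∗-suc : ∀ f g n → (θ f ∗ g) (suc n) ≈ (derivative f ∗ g) n
  θ-∗-suc f g n = trans (+-congʳ (zeroˡ _)) (+-identityˡ _)

  derivative-leibniz : ∀ f g n →
                       derivative (f ∗ g) n ≈ (derivative f ∗ g) n + (f ∗ derivative g) n
  derivative-leibniz f g n = begin
    θ (f ∗ g) (suc n)                            ≈⟨ θ-leibniz f g (suc n) ⟩
    (θ f ∗ g) (suc n) + (f ∗ θ g) (suc n)
      ≈⟨ +-cong (θ-∗-suc f g n) (trans (∗-comm f (θ g) (suc n)) (θ-∗-suc g f n)) ⟩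
    (derivative f ∗ g) n + (derivative g ∗ f) n  ≈⟨ +-congˡ (∗-comm (derivative g) f n) ⟩
    (derivative f ∗ g) n + (f ∗ derivative g) n  ∎

  coefficientwise-leibniz :
    (D : Carrier → Carrier) → (∀ {x y} → x ≈ y → D x ≈ D y) →
    (∀ x y → D (x + y) ≈ D x + D y) → (∀ x y → D (x * y) ≈ D x * y + x * D y) →
    ∀ f g n → D ((f ∗ g) n) ≈ ((λ k → D (f k)) ∗ g) n + (f ∗ (λ k → D (g k))) n
  coefficientwise-leibniz D D-cong D-+ D-* = go
    where
    go : ∀ f g n → D ((f ∗ g) n) ≈ ((λ k → D (f k)) ∗ g) n + (f ∗ (λ k → D (g k))) n
    go f g zero = begin
      D (f 0 * g 0 + 0#)                            ≈⟨ D-cong (+-identityʳ _) ⟩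
      D (f 0 * g 0)                                 ≈⟨ D-* _ _ ⟩
      D (f 0) * g 0 + f 0 * D (g 0)                 ≈⟨ +-cong (+-identityʳ _) (+-identityʳ _) ⟨
      D (f 0) * g 0 + 0# + (f 0 * D (g 0) + 0#)     ∎
    go f g (suc n) =
      trans (D-+ _ _) (trans (+-cong (D-* _ _) (go (shift f) g n)) (interchange _ _ _ _))

-- Derivations of a commutative ring.

record IsDerivation {c ℓ : Level} (R : CommutativeRing c ℓ)
  (D : CommutativeRing.Carrier R → CommutativeRing.Carrier R) : Set (c ⊔ ℓ) where

  open CommutativeRing R
  field
    D-cong : ∀ {x y} → x ≈ y → D x ≈ D y
    D-*    : ∀ x y → D (x * y) ≈ D x * y + x * D y

  open RingProperties ring using (x+x≈x⇒x≈0)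
  open SemiringExp semiring using (_^_)
  open SemiringMult semiring using (_×_; ×-comm-*; ×-congʳ)
  open ≈-Reasoning setoid

  D-1 : D 1# ≈ 0#
  D-1 = x+x≈x⇒x≈0 (D 1#) (begin
    D 1# + D 1#             ≈⟨ +-cong (*-identityʳ _) (*-identityˡ _) ⟨
    D 1# * 1# + 1# * D 1#   ≈⟨ D-* 1# 1# ⟨
    D (1# * 1#)             ≈⟨ D-cong (*-identityˡ 1#) ⟩
    D 1#                    ∎)

  D-^ : ∀ x n → D (x ^ suc n) ≈ suc n × (x ^ n * D x)
  D-^ x zero    = begin
    D (x * 1#)          ≈⟨ D-cong (*-identityʳ x) ⟩
    D x                 ≈⟨ *-identityˡ _ ⟨
    1# * D x            ≈⟨ +-identityʳ _ ⟨
    1# * D x + 0#       ∎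
  D-^ x (suc n) = begin
    D (x * x ^ suc n)                              ≈⟨ D-* _ _ ⟩
    D x * x ^ suc n + x * D (x ^ suc n)            ≈⟨ +-cong (*-comm _ _) (*-congˡ (D-^ x n)) ⟩
    x ^ suc n * D x + x * (suc n × (x ^ n * D x))  ≈⟨ +-congˡ (×-comm-* (suc n) _ _) ⟩
    x ^ suc n * D x + suc n × (x * (x ^ n * D x))  ≈⟨ +-congˡ (×-congʳ (suc n) (*-assoc _ _ _)) ⟨
    suc (suc n) × (x ^ suc n * D x)                ∎

-- Scalars, polynomials in y and series in x⁻¹ over `K`.

module Calculus {c ℓ₁ ℓ₂ : Level} (K : PartiallyOrderedExtensionOfℚ c ℓ₁ ℓ₂) where

  open PartiallyOrderedExtensionOfℚ K
  open Expansion K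
  module 𝓟 = PowerSeries commutativeRing
  module 𝓢 = PowerSeries 𝓟.commutativeRing
  open 𝓢 using (_∗_; shift; θ)
  module PolyRing = CommutativeRing 𝓟.commutativeRing
  module SeriesRing = CommutativeRing 𝓢.commutativeRing
  open CommutativeMonoidMult +-commutativeMonoid using (×-distrib-+)
  open SemiringExp semiring using (_^_; ^-congʳ; ^-homo-*)
  open SemiringExp SeriesRing.semiring using () renaming (_^_ to _^∗_)
  open SemiringMult semiring
    using (×-comm-*; ×-assoc-*; ×-assocˡ; ×-cong; ×-congˡ; ×-congʳ; ×-homo-+; ×1-homo-*)
    renaming (_×_ to infixr 7.5 _⋆_)
  open SemiringMult SeriesRing.semiring using () renaming (_×_ to _⋆ˢ_)
  open SemiringSum semiring using (sum; sum-syntax)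
  open SemiringSum PolyRing.semiring using () renaming (sum to sumᵖ)
  open RingProperties ring using (-1*x≈-x; -0#≈0#; -‿involutive; -‿distribʳ-*)
  open ≈-Reasoning setoid
  module ι = RingMorphisms.IsRingMonomorphism ι-isRingMonomorphism

  x-0≈x : ∀ x → x - 0# ≈ x
  x-0≈x x = trans (+-congˡ -0#≈0#) (+-identityʳ x)

  ι-fromℕ : ∀ n → n ⋆ 1# ≈ ι (+ n ℚ./ 1)
  ι-fromℕ zero    = sym ι.0#-homo
  ι-fromℕ (suc n) = begin
    1# + n ⋆ 1#                     ≈⟨ +-cong (sym ι.1#-homo) (ι-fromℕ n) ⟩
    ι ℚ.1ℚ + ι (+ n ℚ./ 1)          ≈⟨ ι.+-homo _ _ ⟨
    ι (ℚ.1ℚ ℚ.+ (+ n ℚ./ 1))        ≈⟨ reflexive (cong ι (1+n/1≡[1+n]/1 n)) ⟩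
    ι (+ suc n ℚ./ 1)               ∎

  recip-cancel : ∀ n .{{_ : ℕ.NonZero n}} x → recip n * (n ⋆ x) ≈ x
  recip-cancel n x = begin
    recip n * (n ⋆ x)                      ≈⟨ *-congˡ (×-congʳ n (*-identityˡ x)) ⟨
    recip n * (n ⋆ (1# * x))               ≈⟨ *-congˡ (×-assoc-* n 1# x) ⟨
    recip n * (n ⋆ 1# * x)                 ≈⟨ *-assoc _ _ _ ⟨
    recip n * n ⋆ 1# * x                   ≈⟨ *-congʳ (*-congˡ (ι-fromℕ n)) ⟩
    recip n * ι (+ n ℚ./ 1) * x            ≈⟨ *-congʳ (ι.*-homo _ _) ⟨
    ι ((+ 1 ℚ./ n) ℚ.* (+ n ℚ./ 1)) * x    ≈⟨ *-congʳ (reflexive (cong ι (1/n*n/1≡1 n))) ⟩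
    ι ℚ.1ℚ * x                             ≈⟨ *-congʳ ι.1#-homo ⟩
    1# * x                                 ≈⟨ *-identityˡ x ⟩
    x                                      ∎

  -- The ring solver takes its constants from ℚ, where equality is decidable.
  ι-morphism : ℚ.+-*-rawRing -Raw-AlmostCommutative⟶ fromCommutativeRing commutativeRing
  ι-morphism = record
    { ⟦_⟧ = ι ; +-homo = ι.+-homo ; *-homo = ι.*-homo ; -‿homo = ι.-‿homo
    ; 0-homo = ι.0#-homo ; 1-homo = ι.1#-homo }

  ι-≟ : ∀ p q → Maybe (ι p ≈ ι q)
  ι-≟ p q = map (λ p≡q → reflexive (cong ι p≡q)) (dec⇒maybe (p ℚ.≟ q))

  open RingSolver ℚ.+-*-rawRing (fromCommutativeRing commutativeRing) ι-morphism ι-≟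
    using (solve; _:+_; _:*_; _:-_; :-_; _:=_)

  -- Multiples in this form are ring expressions, so that the solver applies to them.
  ⋆≈⋆1* : ∀ n x → n ⋆ x ≈ n ⋆ 1# * x
  ⋆≈⋆1* n x = trans (×-congʳ n (sym (*-identityˡ x))) (sym (×-assoc-* n 1# x))

  sum-snoc : ∀ n (t : ℕ → Carrier) → ∑[ i < suc n ] t (toℕ i) ≈ ∑[ i < n ] t (toℕ i) + t n
  sum-snoc zero    t = +-comm _ _
  sum-snoc (suc n) t = trans (+-congˡ (sum-snoc n (λ i → t (suc i)))) (sym (+-assoc _ _ _))

  sumᵖ-at : ∀ {n} (t : Fin n → Poly) j → sumᵖ t j ≈ sum (λ i → t i j)
  sumᵖ-at {zero}  t j = refl
  sumᵖ-at {suc n} t j = +-congˡ (sumᵖ-at (λ i → t (suc i)) j)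

  -- The product `*ˢ` adds scalars for each power of y, while `∗` adds whole polynomials; the ring
  -- laws are proved for `∗`.
  *ˢ≈∗ : ∀ f g → f *ˢ g ≈ˢ f ∗ g
  *ˢ≈∗ f g n j = sym (sumᵖ-at {suc n} (λ i → f (toℕ i) *ᵖ g (n ∸ toℕ i)) j)

  y^0≈one : y^ 0 ≈ᵖ 𝓟.one
  y^0≈one zero    = refl
  y^0≈one (suc j) = refl

  1ˢ≈one : 1ˢ ≈ˢ 𝓢.one
  1ˢ≈one zero    = y^0≈one
  1ˢ≈one (suc n) = λ _ → refl

  ^ˢ≈^∗ : ∀ f m → f ^ˢ m ≈ˢ f ^∗ m
  ^ˢ≈^∗ f zero    = 1ˢ≈one
  ^ˢ≈^∗ f (suc m) = SeriesRing.trans (*ˢ≈∗ f (f ^ˢ m)) (SeriesRing.*-congˡ {f} (^ˢ≈^∗ f m))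

  ⋆ˢ-at : ∀ m f n j → (m ⋆ˢ f) n j ≈ m ⋆ f n j
  ⋆ˢ-at zero    f n j = refl
  ⋆ˢ-at (suc m) f n j = +-congˡ (⋆ˢ-at m f n j)

  scale : Carrier → Series → Series
  scale r f n j = r * f n j

  scale-∗ : ∀ r f g → scale r f ∗ g ≈ˢ scale r (f ∗ g)
  scale-∗ r f g zero    j =
    trans (+-cong (𝓟.·-∗-assoc r (f 0) (g 0) j) (sym (zeroʳ r))) (sym (distribˡ _ _ _))
  scale-∗ r f g (suc n) j =
    trans (+-cong (𝓟.·-∗-assoc r (f 0) (g (suc n)) j) (scale-∗ r (shift f) g n j))
          (sym (distribˡ _ _ _))

  ∗-scale : ∀ r f g → f ∗ scale r g ≈ˢ scale r (f ∗ g)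
  ∗-scale r f g n j = begin
    (f ∗ scale r g) n j   ≈⟨ 𝓢.∗-comm f (scale r g) n j ⟩
    (scale r g ∗ f) n j   ≈⟨ scale-∗ r g f n j ⟩
    r * (g ∗ f) n j       ≈⟨ *-congˡ (𝓢.∗-comm g f n j) ⟩
    r * (f ∗ g) n j       ∎

  -- Orders of vanishing in x⁻¹ add up; here `f` has order at least 1.
  ∗-vanish : ∀ m {f g} → f 0 ≈ᵖ 0ᵖ → (∀ n → n ℕ.< m → g n ≈ᵖ 0ᵖ) →
             ∀ n → n ℕ.< suc m → (f ∗ g) n ≈ᵖ 0ᵖ
  ∗-vanish m {f} {g} f₀≈0 g≈0 zero    _         = 𝓢.∗-zeroˡ {f} g 0 λ { zero _ → f₀≈0 }
  ∗-vanish m {f} {g} f₀≈0 g≈0 (suc n) (s≤s n<m) = PolyRing.trans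
    (PolyRing.+-cong (PolyRing.trans (PolyRing.*-congʳ f₀≈0) (PolyRing.zeroˡ (g (suc n))))
                  (𝓢.∗-zeroʳ (shift f) n (λ k k≤n → g≈0 k (ℕ.≤-<-trans k≤n n<m))))
    (PolyRing.+-identityˡ 0ᵖ)

  -- A derivation acting on the coefficient of x⁻ⁿ as δ n; below it is ∂/∂y or - x ∂/∂x.
  record GradedDerivation (δ : ℕ → Poly → Poly) : Set (c ⊔ ℓ₁) where
    D : Series → Series
    D f n = δ n (f n)
    field
      δ-cong  : ∀ n {p q} → p ≈ᵖ q → δ n p ≈ᵖ δ n q
      δ-+     : ∀ n p q → δ n (p PolyRing.+ q) ≈ᵖ δ n p PolyRing.+ δ n q
      δ-scale : ∀ n r p → δ n (r 𝓟.· p) ≈ᵖ r 𝓟.· δ n p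
      leibniz : ∀ f g → D (f ∗ g) ≈ˢ (D f ∗ g) +ˢ (f ∗ D g)

    D-cong : ∀ {f g} → f ≈ˢ g → D f ≈ˢ D g
    D-cong f≈g n = δ-cong n (f≈g n)

    D-isDerivation : IsDerivation 𝓢.commutativeRing D
    D-isDerivation = record { D-cong = λ {f} {g} → D-cong {f} {g} ; D-* = leibniz }

    open IsDerivation D-isDerivation public using (D-1; D-^)

    δ-0 : ∀ n → δ n 0ᵖ ≈ᵖ 0ᵖ
    δ-0 n j = begin
      δ n 0ᵖ j              ≈⟨ δ-cong n (λ _ → sym (zeroˡ 0#)) j ⟩
      δ n (0# 𝓟.· 0ᵖ) j     ≈⟨ δ-scale n 0# 0ᵖ j ⟩
      0# * δ n 0ᵖ j         ≈⟨ zeroˡ _ ⟩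
      0#                    ∎

  -- The logarithm and the logarithmic derivative.

  module Logarithm (V : Series) (V₀≈1 : V 0 ≈ᵖ y^ 0) where

    W : Series
    W = V -ˢ 1ˢ

    W₀≈0 : W 0 ≈ᵖ 0ᵖ
    W₀≈0 j = trans (+-congʳ (V₀≈1 j)) (-‿inverseʳ _)

    V≈1+W : V ≈ˢ 𝓢.one SeriesRing.+ W
    V≈1+W n j = begin
      V n j                              ≈⟨ +-identityʳ _ ⟨
      V n j + 0#                         ≈⟨ +-congˡ (-‿inverseʳ _) ⟨
      V n j + (1ˢ n j - 1ˢ n j)          ≈⟨ x∙yz≈y∙xz _ _ _ ⟩
      1ˢ n j + W n j                     ≈⟨ +-congʳ (1ˢ≈one n j) ⟩
      𝓢.one n j + W n j                  ∎
      where open CommutativeSemigroupProperties +-commutativeSemigroup using (x∙yz≈y∙xz)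

    term : ℕ → Series
    term i n j = (- 1#) ^ i * recip (suc i) * (W ^ˢ suc i) n j

    -- In `log` the number of summands depends on the index of the coefficient. A common cut-off `N`
    -- gives a finite sum of series, to which derivations and products apply.
    partialLog : ℕ → Series
    partialLog N n j = ∑[ i < N ] term (toℕ i) n j

    W^m-vanish : ∀ m n → n ℕ.< m → (W ^∗ m) n ≈ᵖ 0ᵖ
    W^m-vanish (suc m) = ∗-vanish m {W} W₀≈0 (W^m-vanish m)

    term-vanish : ∀ i n → n ℕ.≤ i → term i n ≈ᵖ 0ᵖ
    term-vanish i n n≤i j =
      trans (*-congˡ (trans (^ˢ≈^∗ W (suc i) n j) (W^m-vanish (suc i) n (s≤s n≤i) j))) (zeroʳ _)

    partialLog-stable : ∀ {n N} → n ℕ.≤′ N → partialLog N n ≈ᵖ log V n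
    partialLog-stable     ℕ.≤′-refl              j = refl
    partialLog-stable {n} (ℕ.≤′-step {N} n≤N) j = begin
      partialLog (suc N) n j             ≈⟨ sum-snoc N (λ i → term i n j) ⟩
      partialLog N n j + term N n j
        ≈⟨ +-cong (partialLog-stable n≤N j) (term-vanish N n (ℕ.≤′⇒≤ n≤N) j) ⟩
      log V n j + 0#                     ≈⟨ +-identityʳ _ ⟩
      log V n j                          ∎

    module _ {δ : ℕ → Poly → Poly} (isDerivation : GradedDerivation δ) where
      open GradedDerivation isDerivation

      D-V : D V ≈ˢ D W
      D-V n j = begin
        D V n j                                 ≈⟨ D-cong V≈1+W n j ⟩
        D (𝓢.one SeriesRing.+ W) n j              ≈⟨ δ-+ n (𝓢.one n) (W n) j ⟩
        D 𝓢.one n j + D W n j                   ≈⟨ +-congʳ (D-1 n j) ⟩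
        0# + D W n j                            ≈⟨ +-identityˡ _ ⟩
        D W n j                                 ∎

      -- `G i` is (- W)ⁱ D W, the derivative of `term i`: a geometric progression of ratio - W.
      G : ℕ → Series
      G zero    = D W
      G (suc i) = SeriesRing.- (W ∗ G i)

      G-vanish : ∀ i n → n ℕ.< i → G i n ≈ᵖ 0ᵖ
      G-vanish (suc i) n n<1+i j =
        trans (-‿cong (∗-vanish i {W} W₀≈0 (G-vanish i) n n<1+i j)) -0#≈0#

      G≈scaled : ∀ i → G i ≈ˢ scale ((- 1#) ^ i) (W ^∗ i ∗ D W)
      G≈scaled zero    n j = sym (trans (*-identityˡ _) (𝓢.∗-identityˡ (D W) n j))
      G≈scaled (suc i) n j = begin
        - (W ∗ G i) n j
          ≈⟨ -‿cong (SeriesRing.*-congˡ {W} (G≈scaled i) n j) ⟩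
        - (W ∗ scale ((- 1#) ^ i) (W ^∗ i ∗ D W)) n j
          ≈⟨ -‿cong (∗-scale ((- 1#) ^ i) W (W ^∗ i ∗ D W) n j) ⟩
        - ((- 1#) ^ i * (W ∗ (W ^∗ i ∗ D W)) n j)
          ≈⟨ -‿cong (*-congˡ (𝓢.∗-assoc W (W ^∗ i) (D W) n j)) ⟨
        - ((- 1#) ^ i * (W ^∗ suc i ∗ D W) n j)
          ≈⟨ -1*x≈-x _ ⟨
        - 1# * ((- 1#) ^ i * (W ^∗ suc i ∗ D W) n j)
          ≈⟨ *-assoc _ _ _ ⟨
        (- 1#) ^ suc i * (W ^∗ suc i ∗ D W) n j ∎

      D-term : ∀ i → D (term i) ≈ˢ G i
      D-term i n j = begin
        D (term i) n j
          ≈⟨ δ-scale n ((- 1#) ^ i * recip (suc i)) ((W ^ˢ suc i) n) j ⟩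
        (- 1#) ^ i * recip (suc i) * D (W ^ˢ suc i) n j
          ≈⟨ *-congˡ (D-cong (^ˢ≈^∗ W (suc i)) n j) ⟩
        (- 1#) ^ i * recip (suc i) * D (W ^∗ suc i) n j
          ≈⟨ *-congˡ (trans (D-^ W i n j) (⋆ˢ-at (suc i) (W ^∗ i ∗ D W) n j)) ⟩
        (- 1#) ^ i * recip (suc i) * (suc i ⋆ (W ^∗ i ∗ D W) n j)
          ≈⟨ *-assoc _ _ _ ⟩
        (- 1#) ^ i * (recip (suc i) * (suc i ⋆ (W ^∗ i ∗ D W) n j))
          ≈⟨ *-congˡ (recip-cancel (suc i) _) ⟩
        (- 1#) ^ i * (W ^∗ i ∗ D W) n j
          ≈⟨ G≈scaled i n j ⟨
        G i n j ∎

      D-partialLog-suc : ∀ N → D (partialLog (suc N)) ≈ˢ D (partialLog N) +ˢ G N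
      D-partialLog-suc N n j = begin
        D (partialLog (suc N)) n j
          ≈⟨ δ-cong n (λ i → sum-snoc N (λ k → term k n i)) j ⟩
        D (partialLog N SeriesRing.+ term N) n j
          ≈⟨ δ-+ n (partialLog N n) (term N n) j ⟩
        D (partialLog N) n j + D (term N) n j
          ≈⟨ +-congˡ (D-term N n j) ⟩
        D (partialLog N) n j + G N n j ∎

      -- Since V = 1 + W, multiplication by V makes the geometric sum telescope.
      V∗G : ∀ i → V ∗ G i ≈ˢ G i -ˢ G (suc i)
      V∗G i n j = begin
        (V ∗ G i) n j                           ≈⟨ SeriesRing.*-congʳ {G i} V≈1+W n j ⟩
        ((𝓢.one SeriesRing.+ W) ∗ G i) n j        ≈⟨ 𝓢.∗-distribʳ-⊕ (G i) 𝓢.one W n j ⟩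
        (𝓢.one ∗ G i) n j + (W ∗ G i) n j
          ≈⟨ +-cong (𝓢.∗-identityˡ (G i) n j) (sym (-‿involutive _)) ⟩
        G i n j - G (suc i) n j                 ∎

      V∗D-partialLog : ∀ N → V ∗ D (partialLog N) ≈ˢ D V -ˢ G N
      V∗D-partialLog zero    n j = begin
        (V ∗ D (partialLog 0)) n j   ≈⟨ 𝓢.∗-zeroʳ V n (λ k _ → δ-0 k) j ⟩
        0#                           ≈⟨ -‿inverseʳ _ ⟨
        D W n j - D W n j            ≈⟨ +-congʳ (D-V n j) ⟨
        D V n j - D W n j            ∎
      V∗D-partialLog (suc N) n j = begin
        (V ∗ D (partialLog (suc N))) n j
          ≈⟨ SeriesRing.*-congˡ {V} (D-partialLog-suc N) n j ⟩
        (V ∗ (D (partialLog N) SeriesRing.+ G N)) n j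
          ≈⟨ 𝓢.∗-distribˡ-⊕ V (D (partialLog N)) (G N) n j ⟩
        (V ∗ D (partialLog N)) n j + (V ∗ G N) n j
          ≈⟨ +-cong (V∗D-partialLog N n j) (V∗G N n j) ⟩
        D V n j - G N n j + (G N n j - G (suc N) n j)
          ≈⟨ +-assoc _ _ _ ⟨
        D V n j - G N n j + G N n j - G (suc N) n j
          ≈⟨ +-congʳ (trans (+-assoc _ _ _) (trans (+-congˡ (-‿inverseˡ _)) (+-identityʳ _))) ⟩
        D V n j - G (suc N) n j ∎

      -- This is D (log V) = D V / V without division.
      V∗D-log : V ∗ D (log V) ≈ˢ D V
      V∗D-log n j = begin
        (V ∗ D (log V)) n j
          -- With n + 1 summands the partial sum agrees with `log V` up to index `n`, and the
          -- remainder `G (suc n)` has order above `n`.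
          ≈⟨ 𝓢.∗-cong-≤ n {V} (λ _ _ _ → refl) (λ k k≤n →
               δ-cong k (λ i → sym (partialLog-stable (ℕ.≤⇒≤′ (ℕ.m≤n⇒m≤1+n k≤n)) i))) j ⟩
        (V ∗ D (partialLog (suc n))) n j
          ≈⟨ V∗D-partialLog (suc n) n j ⟩
        D V n j - G (suc n) n j
          ≈⟨ +-congˡ (-‿cong (G-vanish (suc n) n ℕ.≤-refl j)) ⟩
        D V n j - 0#
          ≈⟨ x-0≈x _ ⟩
        D V n j ∎

  -- The derivations ∂/∂y and - x ∂/∂x.

  open SemiringMult PolyRing.semiring using () renaming (_×_ to _⋆ᵖ_; ×-congʳ to ⋆ᵖ-congʳ)
  open CommutativeMonoidMult PolyRing.+-commutativeMonoid using ()
    renaming (×-distrib-+ to ⋆ᵖ-distrib-+)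

  ⋆ᵖ-at : ∀ m p j → (m ⋆ᵖ p) j ≈ m ⋆ p j
  ⋆ᵖ-at zero    p j = refl
  ⋆ᵖ-at (suc m) p j = +-congˡ (⋆ᵖ-at m p j)

  ∂y-isDerivation : GradedDerivation (λ _ → d/dy)
  ∂y-isDerivation = record
    { δ-cong  = λ _ → d/dy-cong
    ; δ-+     = λ _ → d/dy-+
    ; δ-scale = λ _ r p j → sym (×-comm-* (suc j) r (p (suc j)))
    ; leibniz = 𝓢.coefficientwise-leibniz d/dy d/dy-cong d/dy-+ 𝓟.derivative-leibniz
    }
    where
    d/dy-cong : ∀ {p q} → p ≈ᵖ q → d/dy p ≈ᵖ d/dy q
    d/dy-cong p≈q j = ×-congʳ (suc j) (p≈q (suc j))
    d/dy-+ : ∀ p q → d/dy (p PolyRing.+ q) ≈ᵖ d/dy p PolyRing.+ d/dy q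
    d/dy-+ p q j = ×-distrib-+ (p (suc j)) (q (suc j)) (suc j)

  θ-isDerivation : GradedDerivation _⋆ᵖ_
  θ-isDerivation = record
    { δ-cong  = ⋆ᵖ-congʳ
    ; δ-+     = λ n p q → ⋆ᵖ-distrib-+ p q n
    ; δ-scale = λ n r p j → trans (⋆ᵖ-at n (r 𝓟.· p) j)
        (trans (sym (×-comm-* n r (p j))) (*-congˡ (sym (⋆ᵖ-at n p j))))
    ; leibniz = 𝓢.θ-leibniz
    }

  ∗-x⁻¹· : ∀ f g → f ∗ (x⁻¹· g) ≈ˢ x⁻¹· (f ∗ g)
  ∗-x⁻¹· f g zero    = 𝓢.∗-zeroʳ f {x⁻¹· g} 0 λ { zero _ _ → refl }
  ∗-x⁻¹· f g (suc n) j = begin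
    (f ∗ (x⁻¹· g)) (suc n) j               ≈⟨ 𝓢.∗-comm f (x⁻¹· g) (suc n) j ⟩
    (0ᵖ *ᵖ f (suc n)) j + (g ∗ f) n j      ≈⟨ +-congʳ (PolyRing.zeroˡ (f (suc n)) j) ⟩
    0# + (g ∗ f) n j                       ≈⟨ +-identityˡ _ ⟩
    (g ∗ f) n j                            ≈⟨ 𝓢.∗-comm g f n j ⟩
    (f ∗ g) n j                            ∎

  -- The recursion for P and Q, and the translation law.

  module Solution (𝓥 : FormalSeries) (isSolution : IsSolution 𝓥) where

    V : Series
    V = coeff 𝓥

    𝐏 𝐐 : Series
    𝐏 = P 𝓥
    𝐐 = Q 𝓥

    V₀≈1 : V 0 ≈ᵖ y^ 0
    V₀≈1 j = begin
      V 0 j                                        ≈⟨ isSolution 0 j ⟩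
      (y^ 0) j + 0# - 0# - 0# - 0# + 0#
        ≈⟨ solve 2 (λ a z → a :+ z :- z :- z :- z :+ z := a :- z) refl _ _ ⟩
      (y^ 0) j - 0#                                ≈⟨ x-0≈x _ ⟩
      (y^ 0) j                                     ∎

    V₀≈one : V 0 ≈ᵖ 𝓟.one
    V₀≈one j = trans (V₀≈1 j) (y^0≈one j)

    d/dy-one : d/dy 𝓟.one ≈ᵖ 0ᵖ
    d/dy-one j = trans (⋆≈⋆1* (suc j) 0#) (zeroʳ _)

    V₀′≈0 : d/dy (V 0) ≈ᵖ 0ᵖ
    V₀′≈0 j = trans (×-congʳ (suc j) (V₀≈one (suc j))) (d/dy-one j)

    P₀ : 𝐏 0 ≈ᵖ λ j → (y^ 1) j - 𝓟.one j
    P₀ j = begin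
      𝐏 0 j
        ≈⟨ isSolution 1 j ⟩
      0# + (y^ 1) j - V 0 j - - 0# - d/dy (V 0) j + 0#
        ≈⟨ +-congʳ (+-cong (+-congʳ (+-congˡ (-‿cong (V₀≈one j)))) (-‿cong (V₀′≈0 j))) ⟩
      0# + (y^ 1) j - 𝓟.one j - - 0# - 0# + 0#
        ≈⟨ solve 3 (λ z a b → z :+ a :- b :- :- z :- z :+ z := a :- b :+ (z :+ z)) refl _ _ _ ⟩
      (y^ 1) j - 𝓟.one j + (0# + 0#)
        ≈⟨ trans (+-congˡ (+-identityˡ 0#)) (+-identityʳ _) ⟩
      (y^ 1) j - 𝓟.one j ∎

    P₀′≈one : d/dy (𝐏 0) ≈ᵖ 𝓟.one
    P₀′≈one j = trans (×-congʳ (suc j) (P₀ (suc j))) (go j)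
      where
      go : ∀ j → suc j ⋆ ((y^ 1) (suc j) - 0#) ≈ 𝓟.one j
      go zero    = trans (+-identityʳ _) (x-0≈x _)
      go (suc j) = trans (×-congʳ (suc (suc j)) (-‿inverseʳ 0#)) (d/dy-one (suc j))

    -- The coefficient of x⁻ⁿ⁻² in the equation: - V/x gives - Pₙ and - V_x gives (n + 1) Pₙ, which
    -- together make n Pₙ.
    P-suc : ∀ n → 𝐏 (suc n) ≈ᵖ λ j → n ⋆ 𝐏 n j - d/dy (𝐏 n) j + 𝐐 (suc n) j
    P-suc n j = begin
      𝐏 (suc n) j
        ≈⟨ isSolution (suc (suc n)) j ⟩
      0# + 0# - 𝐏 n j - - (suc n ⋆ 𝐏 n j) - d/dy (𝐏 n) j + 𝐐 (suc n) j
        ≈⟨ +-congʳ (+-congʳ (+-congʳ (trans (+-congʳ (+-identityˡ 0#)) (+-identityˡ _)))) ⟩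
      - 𝐏 n j - - (𝐏 n j + n ⋆ 𝐏 n j) - d/dy (𝐏 n) j + 𝐐 (suc n) j
        ≈⟨ solve 4 (λ p m d q → :- p :- :- (p :+ m) :- d :+ q := m :- d :+ q) refl _ _ _ _ ⟩
      n ⋆ 𝐏 n j - d/dy (𝐏 n) j + 𝐐 (suc n) j ∎

    P-suc′ : ∀ n j → d/dy (𝐏 (suc n)) j ≈
                     n ⋆ d/dy (𝐏 n) j - d/dy (d/dy (𝐏 n)) j + d/dy (𝐐 (suc n)) j
    P-suc′ n j = begin
      m ⋆ 𝐏 (suc n) m
        ≈⟨ trans (×-congʳ m (P-suc n m)) (⋆≈⋆1* m _) ⟩
      m ⋆ 1# * (n ⋆ p - d + q)
        ≈⟨ *-congˡ (+-congʳ (+-congʳ (⋆≈⋆1* n p))) ⟩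
      m ⋆ 1# * (n ⋆ 1# * p - d + q)
        ≈⟨ solve 5 (λ m n p d q → m :* (n :* p :- d :+ q) := n :* (m :* p) :- m :* d :+ m :* q)
             refl _ _ _ _ _ ⟩
      n ⋆ 1# * (m ⋆ 1# * p) - m ⋆ 1# * d + m ⋆ 1# * q
        ≈⟨ +-cong (+-cong (*-congˡ (⋆≈⋆1* m p)) (-‿cong (⋆≈⋆1* m d))) (⋆≈⋆1* m q) ⟨
      n ⋆ 1# * (m ⋆ p) - m ⋆ d + m ⋆ q
        ≈⟨ +-congʳ (+-congʳ (⋆≈⋆1* n (m ⋆ p))) ⟨
      n ⋆ (m ⋆ p) - m ⋆ d + m ⋆ q ∎
      where
      m = suc j
      p = 𝐏 n m
      d = d/dy (𝐏 n) m
      q = 𝐐 (suc n) m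

    open Logarithm V V₀≈1 using (V∗D-log)

    V∗∂y-Q : V ∗ ∂y 𝐐 ≈ˢ ∂y V
    V∗∂y-Q = V∗D-log ∂y-isDerivation

    V∗θ-Q : V ∗ θ 𝐐 ≈ˢ θ V
    V∗θ-Q = V∗D-log θ-isDerivation

    -- The coefficient of x⁻ⁿ⁻¹ in V + x V_x + (1 - x) V_y = 0.  This identity is the infinitesimal
    -- form of F(x, c + log x) = F(x + c, log (x + c)) for F = x V, which holds because
    -- u = eˣ F(x, c + log x) solves u' = eˣ (log u + c), where c is absorbed by translating x.
    TranslationLaw : ℕ → Set ℓ₁
    TranslationLaw n = ∀ j → d/dy (𝐏 (suc n)) j ≈ d/dy (𝐏 n) j - n ⋆ 𝐏 n j

    -- The law turns the part n Pₙ - P′ₙ of the recursion into - P′ₙ₊₁.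
    Q≈P+P′ : ∀ n → TranslationLaw n → ∀ j → 𝐐 (suc n) j ≈ 𝐏 (suc n) j + d/dy (𝐏 (suc n)) j
    Q≈P+P′ n law j = begin
      𝐐 (suc n) j
        ≈⟨ solve 3 (λ m d q → q := m :- d :+ q :+ (d :- m)) refl (n ⋆ 𝐏 n j) (d/dy (𝐏 n) j) _ ⟩
      n ⋆ 𝐏 n j - d/dy (𝐏 n) j + 𝐐 (suc n) j + (d/dy (𝐏 n) j - n ⋆ 𝐏 n j)
        ≈⟨ +-cong (P-suc n j) (law j) ⟨
      𝐏 (suc n) j + d/dy (𝐏 (suc n)) j ∎

    -- The translation law for log V says that this defect vanishes.
    defect : Series
    defect = ∂y 𝐐 +ˢ x⁻¹· (θ 𝐐 -ˢ ∂y 𝐐 -ˢ 𝓢.one)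

    -- The logarithmic derivative identities clear the denominator V, which turns the law for log V
    -- into the law for V.
    V∗defect : V ∗ defect ≈ˢ ∂y V +ˢ x⁻¹· (θ V -ˢ ∂y V -ˢ V)
    V∗defect n j = begin
      (V ∗ defect) n j
        ≈⟨ 𝓢.∗-distribˡ-⊕ V (∂y 𝐐) (x⁻¹· M) n j ⟩
      (V ∗ ∂y 𝐐) n j + (V ∗ (x⁻¹· M)) n j
        ≈⟨ +-cong (V∗∂y-Q n j) (∗-x⁻¹· V M n j) ⟩
      ∂y V n j + (x⁻¹· (V ∗ M)) n j
        ≈⟨ +-congˡ (tail n) ⟩
      ∂y V n j + (x⁻¹· (θ V -ˢ ∂y V -ˢ V)) n j ∎
      where
      open RingProperties SeriesRing.ring using (x[y-z]≈xy-xz)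
      M : Series
      M = θ 𝐐 -ˢ ∂y 𝐐 -ˢ 𝓢.one
      tail : ∀ n → (x⁻¹· (V ∗ M)) n j ≈ (x⁻¹· (θ V -ˢ ∂y V -ˢ V)) n j
      tail zero    = refl
      tail (suc n) = begin
        (V ∗ M) n j
          ≈⟨ x[y-z]≈xy-xz V (θ 𝐐 -ˢ ∂y 𝐐) 𝓢.one n j ⟩
        (V ∗ (θ 𝐐 -ˢ ∂y 𝐐)) n j - (V ∗ 𝓢.one) n j
          ≈⟨ +-cong (x[y-z]≈xy-xz V (θ 𝐐) (∂y 𝐐) n j) (-‿cong (𝓢.∗-identityʳ V n j)) ⟩
        (V ∗ θ 𝐐) n j - (V ∗ ∂y 𝐐) n j - V n j
          ≈⟨ +-congʳ (+-cong (V∗θ-Q n j) (-‿cong (V∗∂y-Q n j))) ⟩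
        θ V n j - ∂y V n j - V n j ∎

    -- Index k + 2 is the law for `k`, so the laws below `n` reach index n + 1. Indices 0 and 1
    -- follow from V₀ = 1 and P′₀ = 1.
    V∗defect≈0 : ∀ n → (∀ k → k ℕ.< n → TranslationLaw k) →
                 ∀ k → k ℕ.≤ suc n → (V ∗ defect) k ≈ᵖ 0ᵖ
    V∗defect≈0 n law zero          _ j = begin
      (V ∗ defect) 0 j          ≈⟨ V∗defect 0 j ⟩
      d/dy (V 0) j + 0#         ≈⟨ trans (+-identityʳ _) (V₀′≈0 j) ⟩
      0#                        ∎
    V∗defect≈0 n law (suc zero)    _ j = begin
      (V ∗ defect) 1 j
        ≈⟨ V∗defect 1 j ⟩
      d/dy (𝐏 0) j + (0# - d/dy (V 0) j - V 0 j)
        ≈⟨ +-cong (P₀′≈one j) (+-cong (+-congˡ (-‿cong (V₀′≈0 j))) (-‿cong (V₀≈one j))) ⟩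
      𝓟.one j + (0# - 0# - 𝓟.one j)
        ≈⟨ solve 2 (λ z o → o :+ (z :- z :- o) := z :- z) refl _ _ ⟩
      0# - 0#
        ≈⟨ -‿inverseʳ 0# ⟩
      0# ∎
    V∗defect≈0 n law (suc (suc k)) (s≤s k<n) j = begin
      (V ∗ defect) (suc (suc k)) j
        ≈⟨ V∗defect (suc (suc k)) j ⟩
      d/dy (𝐏 (suc k)) j + ((suc k ⋆ᵖ 𝐏 k) j - d/dy (𝐏 k) j - 𝐏 k j)
        ≈⟨ +-cong (law k k<n j) (+-congʳ (+-congʳ (⋆ᵖ-at (suc k) (𝐏 k) j))) ⟩
      d/dy (𝐏 k) j - k ⋆ 𝐏 k j + (𝐏 k j + k ⋆ 𝐏 k j - d/dy (𝐏 k) j - 𝐏 k j)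
        ≈⟨ solve 3 (λ d m p → d :- m :+ (p :+ m :- d :- p) := p :- p) refl _ _ _ ⟩
      𝐏 k j - 𝐏 k j
        ≈⟨ -‿inverseʳ _ ⟩
      0# ∎

    -- Cancelling V, whose constant term is 1, shows that the coefficient n + 1 of `defect`
    -- vanishes. The summand `𝓢.one n` is nonzero only at n = 0, where it yields Q′₁ = 1.
    Q-law : ∀ n → (∀ k → k ℕ.< n → TranslationLaw k) →
            ∀ j → d/dy (𝐐 (suc n)) j ≈ d/dy (𝐐 n) j - n ⋆ 𝐐 n j + 𝓢.one n j
    Q-law n law j = begin
      d/dy (𝐐 (suc n)) j
        ≈⟨ solve 4 (λ e m d o → e := e :+ (m :- d :- o) :+ (d :- m :+ o)) refl _ _ _ _ ⟩
      d/dy (𝐐 (suc n)) j + (n ⋆ 𝐐 n j - d/dy (𝐐 n) j - 𝓢.one n j) + r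
        ≈⟨ +-congʳ (+-congˡ (+-congʳ (+-congʳ (⋆ᵖ-at n (𝐐 n) j)))) ⟨
      defect (suc n) j + r
        ≈⟨ +-congʳ (𝓢.∗-cancelˡ-≤ (suc n) {V} {defect} V₀≈one (V∗defect≈0 n law)
             (suc n) ℕ.≤-refl j) ⟩
      0# + r
        ≈⟨ +-identityˡ r ⟩
      r ∎
      where r = d/dy (𝐐 n) j - n ⋆ 𝐐 n j + 𝓢.one n j

    -- Differentiate the recursion and replace Q′ₙ₊₁ by `Q-law`. For n ≥ 1 the law for n - 1 gives
    -- Qₙ = Pₙ + P′ₙ, after which P″ₙ and n P′ₙ cancel. For n = 0 both sides are 1.
    law-step : ∀ n → (∀ k → k ℕ.< n → TranslationLaw k) → TranslationLaw n
    law-step zero    law j = begin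
      d/dy (𝐏 1) j
        ≈⟨ P-suc′ 0 j ⟩
      0# - d/dy (d/dy (𝐏 0)) j + d/dy (𝐐 1) j
        ≈⟨ +-cong (+-congˡ (-‿cong P₀″≈0)) (Q-law 0 law j) ⟩
      0# - 0# + (d/dy (𝐐 0) j - 0# + 𝓟.one j)
        ≈⟨ +-congˡ (+-congʳ (+-congʳ (d/dy-one j))) ⟩
      0# - 0# + (0# - 0# + 𝓟.one j)
        ≈⟨ solve 2 (λ z o → z :- z :+ (z :- z :+ o) := o :- z :+ z) refl _ _ ⟩
      𝓟.one j - 0# + 0#
        ≈⟨ trans (+-identityʳ _) (+-congʳ (sym (P₀′≈one j))) ⟩
      d/dy (𝐏 0) j - 0# ∎
      where
      P₀″≈0 : d/dy (d/dy (𝐏 0)) j ≈ 0#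
      P₀″≈0 = trans (×-congʳ (suc j) (P₀′≈one (suc j))) (d/dy-one j)
    law-step (suc n) law j = begin
      d/dy (𝐏 (suc m)) j
        ≈⟨ P-suc′ m j ⟩
      m ⋆ p′ - p″ + d/dy (𝐐 (suc m)) j
        ≈⟨ +-congˡ (trans (Q-law m law j) (+-identityʳ _)) ⟩
      m ⋆ p′ - p″ + (d/dy (𝐐 m) j - m ⋆ 𝐐 m j)
        ≈⟨ +-congˡ (+-cong (trans (×-congʳ (suc j) (Q≈ (suc j))) (×-distrib-+ _ _ (suc j)))
                           (-‿cong (trans (×-congʳ m (Q≈ j)) (×-distrib-+ _ _ m)))) ⟩
      m ⋆ p′ - p″ + (p′ + p″ - (m ⋆ p + m ⋆ p′))
        ≈⟨ solve 4 (λ a b c d → a :- b :+ (c :+ b :- (d :+ a)) := c :- d) refl _ _ _ _ ⟩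
      p′ - m ⋆ p ∎
      where
      m = suc n
      p = 𝐏 m j
      p′ = d/dy (𝐏 m) j
      p″ = d/dy (d/dy (𝐏 m)) j
      Q≈ = Q≈P+P′ n (law n ℕ.≤-refl)

    translationLaw : ∀ n → TranslationLaw n
    translationLaw = <-rec TranslationLaw (λ n law → law-step n (λ k k<n → law k<n))

  -- Signs, and natural coefficients over factorial denominators.

  s^_ : ℕ → Carrier
  s^ n = (- 1#) ^ n

  s^-suc : ∀ n → s^ suc n ≈ - s^ n
  s^-suc n = -1*x≈-x (s^ n)

  s^-square : ∀ n → s^ n * s^ n ≈ 1#
  s^-square zero    = *-identityˡ 1#
  s^-square (suc n) = begin
    s^ suc n * s^ suc n     ≈⟨ *-cong (s^-suc n) (s^-suc n) ⟩
    - s^ n * - s^ n         ≈⟨ solve 1 (λ u → :- u :* :- u := u :* u) refl (s^ n) ⟩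
    s^ n * s^ n             ≈⟨ s^-square n ⟩
    1#                      ∎

  -- Implies both integrality and nonnegativity, and is closed under sums and products, so one
  -- induction serves both claims.
  IsNatural : Carrier → Set ℓ₁
  IsNatural x = ∃[ m ] x ≈ m ⋆ 1#

  natural-cong : ∀ {x y} → x ≈ y → IsNatural x → IsNatural y
  natural-cong x≈y (m , x≈m) = m , trans (sym x≈y) x≈m

  natural-+ : ∀ {x y} → IsNatural x → IsNatural y → IsNatural (x + y)
  natural-+ (m , x≈m) (n , y≈n) = m ℕ.+ n , trans (+-cong x≈m y≈n) (sym (×-homo-+ 1# m n))

  natural-* : ∀ {x y} → IsNatural x → IsNatural y → IsNatural (x * y)
  natural-* (m , x≈m) (n , y≈n) = m ℕ.* n , trans (*-cong x≈m y≈n) (sym (×1-homo-* m n))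

  natural-⋆ : ∀ m {x} → IsNatural x → IsNatural (m ⋆ x)
  natural-⋆ m {x} nat = natural-cong (sym (⋆≈⋆1* m x)) (natural-* (m , refl) nat)

  natural⇒integer : ∀ {x} → IsNatural x → IsInteger x
  natural⇒integer (m , x≈m) = + m , trans x≈m (ι-fromℕ m)

  natural⇒0≤ : ∀ {x} → IsNatural x → 0# ≤ x
  natural⇒0≤ (m , x≈m) = ≤-respʳ-≈ (sym x≈m) (go m)
    where
    open IsPartialOrder isPartialOrder using (≤-respʳ-≈; ≤-respˡ-≈) renaming (refl to ≤-refl)
    0≤1 : 0# ≤ 1#
    0≤1 = ≤-respˡ-≈ ι.0#-homo (≤-respʳ-≈ ι.1#-homo
      (IsOrderMonomorphism.mono ι-isOrderMonomorphism (ℚ.nonNegative⁻¹ ℚ.1ℚ)))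
    go : ∀ m → 0# ≤ m ⋆ 1#
    go zero    = ≤-refl
    go (suc m) = ≤-respˡ-≈ (+-identityˡ 0#) (+-mono-≤ 0≤1 (go m))

  -- The sign turns the coefficient x of yʲ into that of tʲ, where t = - y.
  Grade : ℕ → ℕ → Carrier → Set ℓ₁
  Grade n j x = IsNatural (n ! ⋆ (s^ j * x))

  grade-cong : ∀ {n j x y} → x ≈ y → Grade n j x → Grade n j y
  grade-cong {n} x≈y = natural-cong (×-congʳ (n !) (*-congˡ x≈y))

  grade-0 : ∀ {n j} → Grade n j 0#
  grade-0 {n} = 0 , trans (×-congʳ (n !) (zeroʳ _)) (trans (⋆≈⋆1* (n !) 0#) (zeroʳ _))

  grade-+ : ∀ {n j x y} → Grade n j x → Grade n j y → Grade n j (x + y)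
  grade-+ {n} gx gy = natural-cong
    (trans (sym (×-distrib-+ _ _ (n !))) (×-congʳ (n !) (sym (distribˡ _ _ _))))
    (natural-+ gx gy)

  grade-⋆ : ∀ {n j} m {x} → Grade n j x → Grade n j (m ⋆ x)
  grade-⋆ {n} {j} m {x} gx = natural-cong (begin
    m ⋆ n ! ⋆ (s^ j * x)        ≈⟨ ×-assocˡ _ m (n !) ⟩
    (m ℕ.* n !) ⋆ (s^ j * x)    ≈⟨ ×-congˡ (ℕ.*-comm m (n !)) ⟩
    (n ! ℕ.* m) ⋆ (s^ j * x)    ≈⟨ ×-assocˡ _ (n !) m ⟨
    n ! ⋆ m ⋆ (s^ j * x)        ≈⟨ ×-congʳ (n !) (×-comm-* m _ _) ⟨
    n ! ⋆ (s^ j * m ⋆ x)        ∎) (natural-⋆ m gx)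

  -- The denominators are compatible because m! n! divides (m + n)!; the quotient `q` is a binomial
  -- coefficient.
  grade-* : ∀ {m n i j x y} → Grade m i x → Grade n j y → Grade (m ℕ.+ n) (i ℕ.+ j) (x * y)
  grade-* {m} {n} {i} {j} {x} {y} gx gy = natural-cong (begin
    q ⋆ ((m ! ⋆ (s^ i * x)) * (n ! ⋆ (s^ j * y)))
      ≈⟨ ×-congʳ q (trans (×-assoc-* (m !) _ _) (×-congʳ (m !) (×-comm-* (n !) _ _))) ⟩
    q ⋆ m ! ⋆ n ! ⋆ ((s^ i * x) * (s^ j * y))
      ≈⟨ trans (×-congʳ q (×-assocˡ _ (m !) (n !))) (×-assocˡ _ q (m ! ℕ.* n !)) ⟩
    (q ℕ.* (m ! ℕ.* n !)) ⋆ ((s^ i * x) * (s^ j * y))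
      ≈⟨ ×-cong (≡.sym [m+n]!≡q)
           (solve 4 (λ u a v b → (u :* a) :* (v :* b) := (u :* v) :* (a :* b)) refl _ _ _ _) ⟩
    (m ℕ.+ n) ! ⋆ ((s^ i * s^ j) * (x * y))
      ≈⟨ ×-congʳ ((m ℕ.+ n) !) (*-congʳ (^-homo-* (- 1#) i j)) ⟨
    (m ℕ.+ n) ! ⋆ (s^ (i ℕ.+ j) * (x * y)) ∎)
    (natural-⋆ q (natural-* gx gy))
    where
    divisibility = k![n∸k]!∣n! (ℕ.m≤m+n m n)
    q = quotient divisibility
    [m+n]!≡q : (m ℕ.+ n) ! ≡ q ℕ.* (m ! ℕ.* n !)
    [m+n]!≡q = ≡.trans (_∣_.equality divisibility)
      (cong (λ k → q ℕ.* (m ! ℕ.* k !)) (ℕ.m+n∸m≡n m n))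

  -- Dividing by n + 1 costs one grade, as (n + 1)! = n! (n + 1). This undoes `θ` on log V.
  grade-suc : ∀ {n j x} → Grade n j (suc n ⋆ x) → Grade (suc n) j x
  grade-suc {n} {j} {x} = natural-cong (begin
    n ! ⋆ (s^ j * suc n ⋆ x)         ≈⟨ ×-congʳ (n !) (×-comm-* (suc n) _ _) ⟩
    n ! ⋆ suc n ⋆ (s^ j * x)         ≈⟨ ×-assocˡ _ (n !) (suc n) ⟩
    (n ! ℕ.* suc n) ⋆ (s^ j * x)     ≈⟨ ×-congˡ (ℕ.*-comm (n !) (suc n)) ⟩
    suc n ! ⋆ (s^ j * x)             ∎)

  grade-raise : ∀ {n j x} → Grade n j x → Grade (suc n) j x
  grade-raise {n} {j} gx = grade-suc {n} {j} (grade-⋆ {n} {j} (suc n) gx)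

  -- In t = - y the operator - d/dy is d/dt, which preserves natural coefficients.
  grade-d/dy : ∀ {n} p j → Grade n (suc j) (p (suc j)) → Grade n j (- d/dy p j)
  grade-d/dy {n} p j g = natural-cong (×-congʳ (n !) (begin
    s^ suc j * suc j ⋆ x       ≈⟨ *-congʳ (s^-suc j) ⟩
    - s^ j * suc j ⋆ x         ≈⟨ solve 2 (λ u x → :- u :* x := u :* :- x) refl _ _ ⟩
    s^ j * - (suc j ⋆ x)       ∎)) (grade-⋆ {n} {suc j} (suc j) g)
    where x = p (suc j)

  grade-sum : ∀ {n j N} (t : Fin N → Carrier) → (∀ i → Grade n j (t i)) → Grade n j (sum t)
  grade-sum {n} {j} {zero}  t g = grade-0 {n} {j}
  grade-sum {n} {j} {suc N} t g =
    grade-+ {n} {j} (g Fin.zero) (grade-sum {n} {j} (λ i → t (suc i)) (λ i → g (suc i)))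

  grade-*ᵖ : ∀ {m n p q} → (∀ j → Grade m j (p j)) → (∀ j → Grade n j (q j)) →
             ∀ j → Grade (m ℕ.+ n) j ((p *ᵖ q) j)
  grade-*ᵖ {m} {n} {p} {q} gp gq j = grade-sum {m ℕ.+ n} {j} {suc j} _ λ i →
    ≡.subst (λ k → Grade (m ℕ.+ n) k (p (toℕ i) * q (j ∸ toℕ i)))
      (ℕ.m+[n∸m]≡n (toℕ≤pred[n] i))
      (grade-* {m} {n} {toℕ i} (gp (toℕ i)) (gq (j ∸ toℕ i)))

  grade-∗ : ∀ n {f g} → (∀ k → k ℕ.≤ n → ∀ j → Grade k j (f k j)) →
            (∀ k → k ℕ.≤ n → ∀ j → Grade k j (g k j)) → ∀ j → Grade n j ((f ∗ g) n j)
  grade-∗ n {f} {g} gf gg j = grade-cong {n} {j} (*ˢ≈∗ f g n j) (grade-sum {n} {j} {suc n} _ λ i →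
    ≡.subst (λ k → Grade k j ((f (toℕ i) *ᵖ g (n ∸ toℕ i)) j))
      (ℕ.m+[n∸m]≡n (toℕ≤pred[n] i))
      (grade-*ᵖ {toℕ i} {n ∸ toℕ i}
        (gf (toℕ i) (toℕ≤pred[n] i)) (gg (n ∸ toℕ i) (ℕ.m∸n≤m n (toℕ i))) j))

  -- Reading coefficients off a signed expansion.

  sum-zero : ∀ n (t : ℕ → Carrier) → (∀ i → i ℕ.< n → t i ≈ 0#) → ∑[ i < n ] t (toℕ i) ≈ 0#
  sum-zero zero    t t≈0 = refl
  sum-zero (suc n) t t≈0 = trans
    (+-cong (t≈0 0 (s≤s z≤n)) (sum-zero n (λ i → t (suc i)) (λ i i<n → t≈0 (suc i) (s≤s i<n))))
    (+-identityˡ 0#)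

  sum-single : ∀ n (t : ℕ → Carrier) k → k ℕ.< n → (∀ i → i ℕ.< n → i ≢ k → t i ≈ 0#) →
               ∑[ i < n ] t (toℕ i) ≈ t k
  sum-single (suc n) t zero    k<n       t≈0 = trans
    (+-congˡ (sum-zero n (λ i → t (suc i)) (λ i i<n → t≈0 (suc i) (s≤s i<n) λ ())))
    (+-identityʳ _)
  sum-single (suc n) t (suc k) (s≤s k<n) t≈0 = trans
    (+-cong (t≈0 0 (s≤s z≤n) λ ())
            (sum-single n (λ i → t (suc i)) k k<n
              (λ i i<n i≢k → t≈0 (suc i) (s≤s i<n) (λ eq → i≢k (ℕ.suc-injective eq)))))
    (+-identityˡ _)

  y^-diagonal : ∀ m → (y^ m) m ≈ 1#
  y^-diagonal zero    = refl
  y^-diagonal (suc m) = y^-diagonal m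

  y^-off-diagonal : ∀ m j → m ≢ j → (y^ m) j ≈ 0#
  y^-off-diagonal zero    zero    m≢j = contradiction ≡.refl m≢j
  y^-off-diagonal zero    (suc j) m≢j = refl
  y^-off-diagonal (suc m) zero    m≢j = refl
  y^-off-diagonal (suc m) (suc j) m≢j = y^-off-diagonal m j (λ m≡j → m≢j (cong suc m≡j))

  signedExpansion-degree : ∀ n c j → n ℕ.< j → signedExpansion n c j ≈ 0#
  signedExpansion-degree n c j n<j = trans
    (*-congˡ (sum-zero (suc n) (λ i → s^ i * c i * (y^ (n ∸ i)) j) λ i _ → trans
      (*-congˡ (y^-off-diagonal (n ∸ i) j (ℕ.<⇒≢ (ℕ.≤-<-trans (ℕ.m∸n≤m n i) n<j))))
      (zeroʳ _)))
    (zeroʳ _)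

  signedExpansion-at : ∀ n c k → k ℕ.≤ n →
    signedExpansion n c (n ∸ k) ≈ s^ suc n * recip! n * (s^ k * c k)
  signedExpansion-at n c k k≤n = *-congˡ (trans
    (sum-single (suc n) (λ i → s^ i * c i * (y^ (n ∸ i)) (n ∸ k)) k (s≤s k≤n) off)
    (trans (*-congˡ (y^-diagonal (n ∸ k))) (*-identityʳ _)))
    where
    off : ∀ i → i ℕ.< suc n → i ≢ k → s^ i * c i * (y^ (n ∸ i)) (n ∸ k) ≈ 0#
    off i (s≤s i≤n) i≢k = trans
      (*-congˡ (y^-off-diagonal (n ∸ i) (n ∸ k) (λ eq → i≢k (ℕ.∸-cancelˡ-≡ i≤n k≤n eq))))
      (zeroʳ _)

  -- The signs (-1)ⁿ⁺¹ and (-1)ᵏ combine to - (-1)ⁿ⁻ᵏ, so a n k is n! times the coefficient of tⁿ⁻ᵏ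
  -- in - Rₙ, the quantity that `Grade` speaks of.
  coefficient : ∀ {a R} → AreCoefficientsOf a R → ∀ n → 1 ℕ.≤ n → ∀ k → k ℕ.≤ n →
                a n k ≈ n ! ⋆ (s^ (n ∸ k) * - R n (n ∸ k))
  coefficient {a} {R} a-R n 1≤n k k≤n = sym (begin
    n ! ⋆ (u * - R n (n ∸ k))
      ≈⟨ ×-congʳ (n !) (*-congˡ (-‿cong
           (trans (a-R n 1≤n (n ∸ k)) (signedExpansion-at n (a n) k k≤n)))) ⟩
    n ! ⋆ (u * - (s^ suc n * r * (w * a n k)))
      ≈⟨ ×-congʳ (n !) (*-congˡ (-‿cong (*-congʳ (*-congʳ s^1+n≈)))) ⟩
    n ! ⋆ (u * - (- (u * w) * r * (w * a n k)))
      ≈⟨ ×-congʳ (n !) (solve 4 (λ u w r a → u :* :- (:- (u :* w) :* r :* (w :* a))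
           := (u :* u) :* ((w :* w) :* (r :* a))) refl u w r (a n k)) ⟩
    n ! ⋆ ((u * u) * ((w * w) * (r * a n k)))
      ≈⟨ ×-congʳ (n !) (*-cong (s^-square (n ∸ k)) (*-congʳ (s^-square k))) ⟩
    n ! ⋆ (1# * (1# * (r * a n k)))
      ≈⟨ ×-congʳ (n !) (trans (*-identityˡ _) (*-identityˡ _)) ⟩
    n ! ⋆ (r * a n k)
      ≈⟨ ×-comm-* (n !) r (a n k) ⟨
    r * n ! ⋆ a n k
      ≈⟨ recip-cancel (n !) {{n ℕ.!≢0}} (a n k) ⟩
    a n k ∎)
    where
    u = s^ (n ∸ k)
    w = s^ k
    r = recip! n
    s^1+n≈ : s^ suc n ≈ - (u * w)
    s^1+n≈ = begin
      s^ suc n                  ≈⟨ s^-suc n ⟩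
      - s^ n                    ≈⟨ -‿cong (^-congʳ (- 1#) (ℕ.m∸n+n≡m k≤n)) ⟨
      - s^ (n ∸ k ℕ.+ k)        ≈⟨ -‿cong (^-homo-* (- 1#) (n ∸ k) k) ⟩
      - (u * w)                 ∎

  -- Natural coefficients of Aₙ and Bₙ by induction.

  module Integrality (𝓥 : FormalSeries) (isSolution : IsSolution 𝓥) where
    open Solution 𝓥 isSolution

    𝐏⁻ : Series
    𝐏⁻ n j = - 𝐏 n j

    -- The entry `n` is Bₙ₊₁/n!: the index is shifted so that it matches the denominator.
    θ𝐐⁻ : Series
    θ𝐐⁻ n j = - (suc n ⋆ᵖ 𝐐 (suc n)) j

    P⁻-suc : ∀ n j → 𝐏⁻ (suc n) j ≈ n ⋆ 𝐏⁻ n j + - d/dy (𝐏⁻ n) j + - 𝐐 (suc n) j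
    P⁻-suc n j = begin
      - 𝐏 (suc n) j
        ≈⟨ -‿cong (trans (P-suc n j) (+-congʳ (+-cong (⋆≈⋆1* n _) (-‿cong (⋆≈⋆1* (suc j) _))))) ⟩
      - (n ⋆ 1# * 𝐏 n j - suc j ⋆ 1# * 𝐏 n (suc j) + 𝐐 (suc n) j)
        ≈⟨ solve 5 (λ a p b d q → :- (a :* p :- b :* d :+ q) := a :* :- p :+ :- (b :* :- d) :+ :- q)
             refl _ _ _ _ _ ⟩
      n ⋆ 1# * 𝐏⁻ n j + - (suc j ⋆ 1# * 𝐏⁻ n (suc j)) + - 𝐐 (suc n) j
        ≈⟨ +-congʳ (+-cong (⋆≈⋆1* n _) (-‿cong (⋆≈⋆1* (suc j) _))) ⟨
      n ⋆ 𝐏⁻ n j + - d/dy (𝐏⁻ n) j + - 𝐐 (suc n) j ∎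

    -- The coefficient of x⁻ⁿ⁻¹ in V · θ(log V) = θ V, with V₀ = 1 split off.
    θQ-step : ∀ n j → (suc n ⋆ᵖ 𝐐 (suc n)) j + (𝐏 ∗ θ 𝐐) n j ≈ suc n ⋆ 𝐏 n j
    θQ-step n j = begin
      (suc n ⋆ᵖ 𝐐 (suc n)) j + (𝐏 ∗ θ 𝐐) n j
        ≈⟨ +-congʳ (𝓟.∗-identityˡ (suc n ⋆ᵖ 𝐐 (suc n)) j) ⟨
      (𝓟.one *ᵖ (suc n ⋆ᵖ 𝐐 (suc n))) j + (𝐏 ∗ θ 𝐐) n j
        ≈⟨ +-congʳ (PolyRing.*-congʳ {suc n ⋆ᵖ 𝐐 (suc n)} V₀≈one j) ⟨
      (V ∗ θ 𝐐) (suc n) j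
        ≈⟨ V∗θ-Q (suc n) j ⟩
      (suc n ⋆ᵖ 𝐏 n) j
        ≈⟨ ⋆ᵖ-at (suc n) (𝐏 n) j ⟩
      suc n ⋆ 𝐏 n j ∎

    θQ⁻≈ : ∀ n j → θ𝐐⁻ n j ≈ suc n ⋆ 𝐏⁻ n j + (𝐏 ∗ θ 𝐐) n j
    θQ⁻≈ n j = begin
      θ𝐐⁻ n j
        ≈⟨ solve 2 (λ q e → :- q := :- (q :+ e) :+ e) refl _ _ ⟩
      - ((suc n ⋆ᵖ 𝐐 (suc n)) j + (𝐏 ∗ θ 𝐐) n j) + (𝐏 ∗ θ 𝐐) n j
        ≈⟨ +-congʳ (-‿cong (trans (θQ-step n j) (⋆≈⋆1* (suc n) _))) ⟩
      - (suc n ⋆ 1# * 𝐏 n j) + (𝐏 ∗ θ 𝐐) n j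
        ≈⟨ +-congʳ (trans (-‿distribʳ-* _ _) (sym (⋆≈⋆1* (suc n) _))) ⟩
      suc n ⋆ 𝐏⁻ n j + (𝐏 ∗ θ 𝐐) n j ∎

    -- The two sign changes cancel, so the convolution enters with a plus sign. As θ(log V) has no
    -- constant term, the index drops by one and only earlier entries occur.
    P∗θQ-suc : ∀ n j → (𝐏 ∗ θ 𝐐) (suc n) j ≈ (θ𝐐⁻ ∗ 𝐏⁻) n j
    P∗θQ-suc n j = begin
      (𝐏 ∗ θ 𝐐) (suc n) j            ≈⟨ 𝓢.∗-comm 𝐏 (θ 𝐐) (suc n) j ⟩
      (θ 𝐐 ∗ 𝐏) (suc n) j            ≈⟨ 𝓢.θ-∗-suc 𝐐 𝐏 n j ⟩
      (𝓢.derivative 𝐐 ∗ 𝐏) n j       ≈⟨ -‿involutive _ ⟨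
      - - (𝓢.derivative 𝐐 ∗ 𝐏) n j   ≈⟨ -‿cong (-‿distribʳ-∗ (𝓢.derivative 𝐐) 𝐏 n j) ⟩
      - (𝓢.derivative 𝐐 ∗ 𝐏⁻) n j    ≈⟨ -‿distribˡ-∗ (𝓢.derivative 𝐐) 𝐏⁻ n j ⟩
      (θ𝐐⁻ ∗ 𝐏⁻) n j                 ∎
      where
      open RingProperties SeriesRing.ring using ()
        renaming (-‿distribˡ-* to -‿distribˡ-∗; -‿distribʳ-* to -‿distribʳ-∗)

    -- - P₀ = 1 - y = 1 + t.
    grade-P₀ : ∀ j → Grade 0 j (𝐏⁻ 0 j)
    grade-P₀ j = grade-cong {0} {j} (sym (-‿cong (P₀ j))) (go j)
      where
      go : ∀ j → Grade 0 j (- ((y^ 1) j - 𝓟.one j))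
      go zero          = 1 , ×-congʳ 1 (trans (*-identityˡ _) (trans
        (solve 2 (λ z o → :- (z :- o) := o :- z) refl 0# 1#) (x-0≈x 1#)))
      go (suc zero)    = 1 , ×-congʳ 1 (begin
        - 1# * 1# * - (1# - 0#)   ≈⟨ *-cong (*-identityʳ _) (-‿cong (x-0≈x 1#)) ⟩
        - 1# * - 1#               ≈⟨ solve 1 (λ o → :- o :* :- o := o :* o) refl 1# ⟩
        1# * 1#                   ≈⟨ *-identityˡ 1# ⟩
        1#                        ∎)
      go (suc (suc j)) = grade-cong {0} {suc (suc j)}
        (sym (trans (-‿cong (-‿inverseʳ 0#)) -0#≈0#)) (grade-0 {0} {suc (suc j)})

    grade-Q : ∀ n j → Grade n j (θ𝐐⁻ n j) → Grade (suc n) j (- 𝐐 (suc n) j)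
    grade-Q n j g = grade-suc {n} {j} (grade-cong {n} {j} (begin
      θ𝐐⁻ n j
        ≈⟨ -‿cong (trans (⋆ᵖ-at (suc n) (𝐐 (suc n)) j) (⋆≈⋆1* (suc n) _)) ⟩
      - (suc n ⋆ 1# * 𝐐 (suc n) j)         ≈⟨ trans (-‿distribʳ-* _ _) (sym (⋆≈⋆1* (suc n) _)) ⟩
      suc n ⋆ - 𝐐 (suc n) j                ∎) g)

    -- Both families go through one induction: Aₙ₊₁ needs Aₙ and Bₙ₊₁, then Bₙ₊₂ needs Aₙ₊₁ and a
    -- convolution. The range k ≤ n supplies all the earlier entries of that convolution.
    grades : ∀ n k → k ℕ.≤ n → Σ[ _ ∈ (∀ j → Grade k j (𝐏⁻ k j)) ] (∀ j → Grade k j (θ𝐐⁻ k j))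
    grades zero    zero _ = grade-P₀ , λ j → grade-cong {0} {j} (sym (begin
      θ𝐐⁻ 0 j                              ≈⟨ θQ⁻≈ 0 j ⟩
      1 ⋆ 𝐏⁻ 0 j + (𝐏 ∗ θ 𝐐) 0 j
        ≈⟨ +-congˡ (𝓢.∗-zeroʳ 𝐏 {θ 𝐐} 0 (λ { zero _ _ → refl }) j) ⟩
      1 ⋆ 𝐏⁻ 0 j + 0#                      ≈⟨ +-identityʳ _ ⟩
      1 ⋆ 𝐏⁻ 0 j                           ∎)) (grade-⋆ {0} {j} 1 (grade-P₀ j))
    grades (suc n) k k≤1+n with ℕ.m≤n⇒m<n∨m≡n k≤1+n
    ... | inj₁ (s≤s k≤n) = grades n k k≤n
    ... | inj₂ ≡.refl    = grade-P , grade-θQ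
      where
      ih = grades n
      grade-P : ∀ j → Grade (suc n) j (𝐏⁻ (suc n) j)
      grade-P j = grade-cong {suc n} {j} (sym (P⁻-suc n j))
        (grade-+ {suc n} {j}
          -- Terms of index `n` are brought over the denominator (n + 1)!, whence the factor n + 1
          -- in the recursion for A; Qₙ₊₁ already has that denominator.
          (grade-raise {n} {j}
            (grade-+ {n} {j} (grade-⋆ {n} {j} n (proj₁ (ih n ℕ.≤-refl) j))
                             (grade-d/dy {n} (𝐏⁻ n) j (proj₁ (ih n ℕ.≤-refl) (suc j)))))
          (grade-Q n j (proj₂ (ih n ℕ.≤-refl) j)))
      grade-θQ : ∀ j → Grade (suc n) j (θ𝐐⁻ (suc n) j)
      grade-θQ j = grade-cong {suc n} {j}
        (sym (trans (θQ⁻≈ (suc n) j) (+-congˡ (P∗θQ-suc n j))))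
        (grade-+ {suc n} {j} (grade-⋆ {suc n} {j} (suc (suc n)) (grade-P j))
          (grade-raise {n} {j} (grade-∗ n {θ𝐐⁻} {𝐏⁻}
            (λ k k≤n → proj₂ (ih k k≤n)) (λ k k≤n → proj₁ (ih k k≤n)) j)))

    -- Naturality, monotonicity and leading terms of the coefficients a and b.

    module Coefficients (a b : ℕ → ℕ → Carrier)
      (a-P : AreCoefficientsOf a 𝐏) (b-Q : AreCoefficientsOf b 𝐐) where

      a-natural : ∀ n → 1 ℕ.≤ n → ∀ k → k ℕ.≤ n → IsNatural (a n k)
      a-natural n 1≤n k k≤n = natural-cong (sym (coefficient {a} {𝐏} a-P n 1≤n k k≤n))
        (proj₁ (grades n n ℕ.≤-refl) (n ∸ k))

      b-natural : ∀ n → 1 ℕ.≤ n → ∀ k → k ℕ.≤ n → IsNatural (b n k)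
      b-natural n@(suc m) 1≤n k k≤n = natural-cong (sym (coefficient {b} {𝐐} b-Q n 1≤n k k≤n))
        (grade-Q m (n ∸ k) (proj₂ (grades m m ℕ.≤-refl) (n ∸ k)))

      -- The coefficient of tⁿ⁻ᵏ⁻¹ in Aₙ = A′ₙ + Bₙ.
      a-recurrence : ∀ n → 1 ℕ.≤ n → ∀ k → suc k ℕ.≤ n →
                     a n (suc k) ≈ b n (suc k) + (n ∸ k) ⋆ a n k
      a-recurrence n@(suc m) 1≤n k k<n = begin
        a n (suc k)
          ≈⟨ coefficient {a} {𝐏} a-P n 1≤n (suc k) k<n ⟩
        n ! ⋆ (u * - p)
          ≈⟨ ⋆≈⋆1* (n !) _ ⟩
        n ! ⋆ 1# * (u * - p)
          -- The term J p₁ of P′ₙ is added and subtracted; the sign - u in the second summand is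
          -- `s^ suc j`.
          ≈⟨ solve 5 (λ N u p J p₁ → N :* (u :* :- p)
               := N :* (u :* :- (p :+ J :* p₁)) :+ J :* (N :* (:- u :* :- p₁)))
               refl (n ! ⋆ 1#) u p (suc j ⋆ 1#) p₁ ⟩
        n ! ⋆ 1# * (u * - (p + suc j ⋆ 1# * p₁)) + suc j ⋆ 1# * (n ! ⋆ 1# * (- u * - p₁))
          ≈⟨ +-cong
               (trans (⋆≈⋆1* (n !) _) (*-congˡ (*-congˡ (-‿cong
                 (trans (Q≈P+P′ m (translationLaw m) j) (+-congˡ (⋆≈⋆1* (suc j) _)))))))
               (trans (⋆≈⋆1* (suc j) _) (*-congˡ
                 (trans (⋆≈⋆1* (n !) _) (*-congˡ (*-congʳ (s^-suc j)))))) ⟨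
        n ! ⋆ (u * - 𝐐 n j) + suc j ⋆ n ! ⋆ (s^ suc j * - p₁)
          ≈⟨ +-cong (coefficient {b} {𝐐} b-Q n 1≤n (suc k) k<n)
                    (×-cong n∸k≡1+j (trans (coefficient {a} {𝐏} a-P n 1≤n k (ℕ.<⇒≤ k<n))
                      (×-congʳ (n !) (reflexive (cong (λ i → s^ i * - 𝐏 n i) n∸k≡1+j))))) ⟨
        b n (suc k) + (n ∸ k) ⋆ a n k ∎
        where
        j = n ∸ suc k
        u = s^ j
        p = 𝐏 n j
        p₁ = 𝐏 n (suc j)
        n∸k≡1+j : n ∸ k ≡ suc j
        n∸k≡1+j = ℕ.+-∸-assoc 1 (ℕ.≤-pred k<n)

      -- The factor n - k in the recurrence is at least 1, so one copy of `a n k` splits off and a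
      -- natural number remains.
      a-monotone : ∀ n → 1 ℕ.≤ n → ∀ k → suc k ℕ.≤ n → a n k ≤ a n (suc k)
      a-monotone n@(suc m) 1≤n k k<n = ≤-respʳ-≈ (sym (begin
        a n (suc k)                                 ≈⟨ a-recurrence n 1≤n k k<n ⟩
        b n (suc k) + (n ∸ k) ⋆ a n k
          ≈⟨ +-congˡ (×-congˡ (ℕ.+-∸-assoc 1 (ℕ.≤-pred k<n))) ⟩
        b n (suc k) + (a n k + j ⋆ a n k)           ≈⟨ x∙yz≈y∙xz _ _ _ ⟩
        a n k + (b n (suc k) + j ⋆ a n k)           ∎))
        (≤-respˡ-≈ (+-identityʳ _) (+-mono-≤ ≤-refl (natural⇒0≤
          (natural-+ (b-natural n 1≤n (suc k) k<n)
                     (natural-⋆ j (a-natural n 1≤n k (ℕ.<⇒≤ k<n)))))))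
        where
        open IsPartialOrder isPartialOrder using (≤-respʳ-≈; ≤-respˡ-≈) renaming (refl to ≤-refl)
        open CommutativeSemigroupProperties +-commutativeSemigroup using (x∙yz≈y∙xz)
        j = n ∸ suc k

      -- At the top power of y the translation law says that n times the leading coefficient of Pₙ
      -- only changes sign from n to n + 1. The initial value comes from P′₀ = 1.
      leading : ∀ n → suc n ⋆ (s^ suc n * 𝐏⁻ (suc n) (suc n)) ≈ 1#
      leading zero    = begin
        1 ⋆ (- 1# * 1# * - 𝐏 1 1)
          ≈⟨ trans (+-identityʳ _) (*-congʳ (*-identityʳ _)) ⟩
        - 1# * - 𝐏 1 1
          ≈⟨ trans (-1*x≈-x _) (-‿involutive _) ⟩
        𝐏 1 1
          ≈⟨ +-identityʳ _ ⟨
        1 ⋆ 𝐏 1 1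
          ≈⟨ trans (translationLaw 0 0) (x-0≈x _) ⟩
        1 ⋆ 𝐏 0 1
          ≈⟨ P₀′≈one 0 ⟩
        1# ∎
      leading (suc n) = begin
        suc m ⋆ (s^ suc m * - 𝐏 (suc m) (suc m))
          ≈⟨ trans (⋆≈⋆1* (suc m) _) (*-congˡ (*-congʳ (s^-suc m))) ⟩
        suc m ⋆ 1# * (- s^ m * - 𝐏 (suc m) (suc m))
          ≈⟨ solve 3 (λ M u p → M :* (:- u :* :- p) := u :* (M :* p)) refl _ _ _ ⟩
        s^ m * (suc m ⋆ 1# * 𝐏 (suc m) (suc m))
          ≈⟨ *-congˡ (⋆≈⋆1* (suc m) _) ⟨
        s^ m * d/dy (𝐏 (suc m)) m
          ≈⟨ *-congˡ (translationLaw m m) ⟩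
        s^ m * (suc m ⋆ 𝐏 m (suc m) - m ⋆ 𝐏 m m)
          ≈⟨ *-congˡ (+-cong P-top≈0 (-‿cong (⋆≈⋆1* m _))) ⟩
        s^ m * (0# - m ⋆ 1# * 𝐏 m m)
          ≈⟨ *-congˡ (+-identityˡ _) ⟩
        s^ m * - (m ⋆ 1# * 𝐏 m m)
          ≈⟨ solve 3 (λ u M p → u :* :- (M :* p) := M :* (u :* :- p)) refl _ _ _ ⟩
        m ⋆ 1# * (s^ m * - 𝐏 m m)
          ≈⟨ ⋆≈⋆1* m _ ⟨
        m ⋆ (s^ m * - 𝐏 m m)
          ≈⟨ leading n ⟩
        1# ∎
        where
        m = suc n
        -- The expansion of Pₘ by `a m` stops at yᵐ, one power below the bound given by `degree`.
        P-top≈0 : suc m ⋆ 𝐏 m (suc m) ≈ 0#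
        P-top≈0 = trans (×-congʳ (suc m) (trans (a-P m (s≤s z≤n) (suc m))
          (signedExpansion-degree m (a m) (suc m) ℕ.≤-refl))) (d/dy-one m)

      a-leading : ∀ n → a (suc n) 0 ≈ ι (+ (n !) ℚ./ 1)
      a-leading n = begin
        a (suc n) 0                          ≈⟨ coefficient {a} {𝐏} a-P (suc n) (s≤s z≤n) 0 z≤n ⟩
        suc n ! ⋆ x                          ≈⟨ ×-congˡ (ℕ.*-comm (suc n) (n !)) ⟩
        (n ! ℕ.* suc n) ⋆ x                  ≈⟨ ×-assocˡ x (n !) (suc n) ⟨
        n ! ⋆ suc n ⋆ x                      ≈⟨ ×-congʳ (n !) (leading n) ⟩
        n ! ⋆ 1#                             ≈⟨ ι-fromℕ (n !) ⟩
        ι (+ (n !) ℚ./ 1)                    ∎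
        where x = s^ suc n * 𝐏⁻ (suc n) (suc n)

-- Claims (a) to (d) from naturality, the recurrence and the leading coefficients.

open import Data.Product.Base using (_×_)

theorem4p10 : ∀ {c ℓ₁ ℓ₂ : Level} (K : PartiallyOrderedExtensionOfℚ c ℓ₁ ℓ₂) →
    let open PartiallyOrderedExtensionOfℚ K
        open Expansion K
    in (V : FormalSeries) → IsSolution V →
       (a b : ℕ → ℕ → Carrier) →
       AreCoefficientsOf a (P V) → AreCoefficientsOf b (Q V) →
       ∀ n → 1 ℕ.≤ n →
         (∀ k → k ℕ.≤ n → IsInteger (b n k)) ×
         (∀ k → k ℕ.≤ n → (0# ≤ a n k) × (0# ≤ b n k)) ×
         (∀ k → 1 ℕ.≤ k → k ℕ.≤ n → a n (k ∸ 1) ≤ a n k) ×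
         (a n 0 ≈ ι ((+ ((n ∸ 1) !)) ℚ./ 1))
theorem4p10 K V isSolution a b a-P b-Q n@(suc m) 1≤n =
    (λ k k≤n → natural⇒integer (b-natural n 1≤n k k≤n))
  , (λ k k≤n → natural⇒0≤ (a-natural n 1≤n k k≤n)
             , natural⇒0≤ (b-natural n 1≤n k k≤n))
  , (λ { (suc k) _ k<n → a-monotone n 1≤n k k<n })
  , a-leading m
  where
  open Calculus K
  open Integrality V isSolution
  open Coefficients a b a-P b-Q
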